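{- Let $k\ge 2$ be a fixed integer. The property of a graph $G$ being a $k$-leaf power can be expressed as an $\mathrm{MSO}_2$ formula of $G\boxtimes C_k$ and of the set of horizontal edges of this graph product. That is, there is an $\mathrm{MSO}_2$ formula $\varphi_k(H)$ with one free edge-set variable $H$ such that a graph $G$ is a $k$-leaf power if and only if $\varphi_k$ is true in the graph $G\boxtimes C_k$ when $H$ is interpreted as the set of horizontal edges of $G\boxtimes C_k$.
   Context: Graphs are finite, simple and undirected. For a tree $T$, the $k$th leaf power of $T$ is the graph whose vertices are the leaves of $T$ and in which two distinct leaves are adjacent if and only if they are connected by a path of at most $k$ edges in $T$. $G$ is a $k$-leaf power if it is (up to identification of the vertices of $G$ with the leaves of $T$) the $k$th leaf power of some tree $T$. $C_k$ denotes the $k$-vertex cycle graph (for $k=2$, read as a single edge on two vertices). The strong product $G_1\boxtimes G_2$ has as vertices the ordered pairs of a vertex of $G_1$ and a vertex of $G_2$; two distinct vertices $(u_1,u_2)$ and $(v_1,v_2)$ are adjacent if and only if for each $i\in\{1,2\}$, $u_i=v_i$ or $u_i$ and $v_i$ are adjacent in $G_i$. An edge of $G_1\boxtimes G_2$ from $(u_1,u_2)$ to $(v_1,v_2)$ is horizontal if $u_1=v_1$. $\mathrm{MSO}_2$ is the monadic second-order logic of graphs with variables for vertices, edges, sets of vertices and sets of edges (of the graph to which the formula is applied), quantification over all of these, and the predicates of equality, set membership, and incidence between an edge and a vertex. -}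

module Defs where

open import Data.Bool using (Bool; T)
open import Data.Empty using (⊥)
open import Data.Fin using (Fin; toℕ)
open import Data.Fin.Properties using (inj⇒≟; *↔×) renaming (_≟_ to _≟ᶠ_)
open import Data.List using (List; []; _∷_)
open import Data.List.Membership.Propositional using (_∈_)
open import Data.List.Relation.Unary.All using (All; []; _∷_; lookup)
open import Data.List.Relation.Unary.Unique.Propositional using (Unique)
open import Data.Nat using (ℕ; suc; _≤_)
import Data.Nat.Properties as ℕ
open import Data.Product using (Σ; ∃-syntax; ∃!; _×_; _,_; proj₁)
open import Data.Product.Function.NonDependent.Propositional using (_×-↔_)
open import Data.Product.Properties using (≡-dec)
open import Data.Sum using (_⊎_; inj₁; inj₂)
import Data.Sum as Sum
open import Function.Bundles using (_↔_; _⇔_)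
open import Function.Construct.Identity using (↔-id)
open import Function.Definitions using (Injective)
open import Function.Properties.Inverse using (↔-sym; ↔-trans; ↔⇒↣)
open import Relation.Binary.Construct.Closure.ReflexiveTransitive using (Star; ε; _◅_)
open import Relation.Binary.Definitions using (Decidable; DecidableEquality; Irreflexive; Symmetric)
open import Relation.Binary.PropositionalEquality using (_≡_; _≢_; refl; sym)
open import Relation.Nullary using (¬_; yes; no)
open import Relation.Nullary.Decidable using (⌊_⌋; ¬?; _×-dec_; _⊎-dec_)

record Graph : Set₁ where
  field
    V      : Set
    order  : ℕ
    finite : V ↔ Fin order
    Adj    : V → V → Set
    adj?   : Decidable Adj
    symm   : Symmetric Adj
    irrefl : Irreflexive _≡_ Adj

  _≟_ : DecidableEquality V
  _≟_ = inj⇒≟ (↔⇒↣ finite)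

  Walk : V → V → Set
  Walk = Star Adj

  length : ∀ {u v} → Walk u v → ℕ
  length ε       = 0
  length (_ ◅ p) = suc (length p)

  vertices : ∀ {u v} → Walk u v → List V
  vertices {u} ε       = u ∷ []
  vertices {u} (_ ◅ p) = u ∷ vertices p

  IsPath : ∀ {u v} → Walk u v → Set
  IsPath p = Unique (vertices p)

  Connected : Set
  Connected = V × (∀ u v → ∃[ p ] IsPath {u} {v} p)

  -- A cycle is a path with at least two edges together with an edge
  -- joining its endpoints.
  Acyclic : Set
  Acyclic = ∀ {u v} (p : Walk u v) → IsPath p → 2 ≤ length p → ¬ Adj v u

  IsTree : Set
  IsTree = Connected × Acyclic

  Leaf : V → Set
  Leaf v = ∃! _≡_ (Adj v)

  -- An edge carries an orientation, which _≈ᴱ_ forgets (along with the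
  -- proof of adjacency).
  record Edge : Set where
    constructor edge
    field
      src tgt  : V
      adjacent : Adj src tgt

  open Edge public

  _≈ᴱ_ : Edge → Edge → Set
  e ≈ᴱ f = (src e ≡ src f × tgt e ≡ tgt f) ⊎ (src e ≡ tgt f × tgt e ≡ src f)

  Incident : Edge → V → Set
  Incident e v = v ≡ src e ⊎ v ≡ tgt e

  -- Boolean membership suffices for all edge sets, as graphs are finite.
  record EdgeSet : Set where
    field
      member : Edge → Bool
      resp   : ∀ {e f} → e ≈ᴱ f → member e ≡ member f

  open EdgeSet public

-- Adjacency in the k-th leaf power of T, for u and v leaves of T.
LeafPowerAdj : ℕ → (T : Graph) → Graph.V T → Graph.V T → Set
LeafPowerAdj k T u v = u ≢ v × (∃[ p ] IsPath {u} {v} p × length p ≤ k)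
  where open Graph T

-- An isomorphism from G to the k-th leaf power of T, given as a bijection
-- from the vertices of G onto the leaves of T.
record LeafPowerIso (k : ℕ) (G T : Graph) : Set where
  private
    module G = Graph G
    module T = Graph T
  field
    to        : G.V → T.V
    injective : Injective _≡_ _≡_ to
    to-leaf   : ∀ v → T.Leaf (to v)
    onto-leaf : ∀ {ℓ} → T.Leaf ℓ → ∃[ v ] to v ≡ ℓ
    adj⇔      : ∀ u v → G.Adj u v ⇔ LeafPowerAdj k T (to u) (to v)

IsLeafPower : ℕ → Graph → Set₁
IsLeafPower k G = ∃[ T ] Graph.IsTree T × LeafPowerIso k G T

module _ {k : ℕ} where

  Next : Fin k → Fin k → Set
  Next i j = toℕ j ≡ suc (toℕ i) ⊎ (suc (toℕ i) ≡ k × toℕ j ≡ 0)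

  next? : Decidable Next
  next? i j =
    (toℕ j ℕ.≟ suc (toℕ i)) ⊎-dec ((suc (toℕ i) ℕ.≟ k) ×-dec (toℕ j ℕ.≟ 0))

-- For k = 2 this is a single edge.
cycle : ℕ → Graph
cycle k = record
  { V      = Fin k
  ; order  = k
  ; finite = ↔-id (Fin k)
  ; Adj    = λ i j → i ≢ j × (Next i j ⊎ Next j i)
  ; adj?   = λ i j → ¬? (i ≟ᶠ j) ×-dec (next? i j ⊎-dec next? j i)
  ; symm   = λ (i≢j , n) → (λ j≡i → i≢j (sym j≡i)) , Sum.swap n
  ; irrefl = λ i≡j (i≢j , _) → i≢j i≡j
  }

infixr 7 _⊠_

_⊠_ : Graph → Graph → Graph
G₁ ⊠ G₂ = record
  { V      = G₁.V × G₂.V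
  ; order  = _
  ; finite = ↔-trans (G₁.finite ×-↔ G₂.finite) (↔-sym *↔×)
  ; Adj    = λ (u₁ , u₂) (v₁ , v₂) → (u₁ , u₂) ≢ (v₁ , v₂)
               × (u₁ ≡ v₁ ⊎ G₁.Adj u₁ v₁) × (u₂ ≡ v₂ ⊎ G₂.Adj u₂ v₂)
  ; adj?   = λ (u₁ , u₂) (v₁ , v₂) →
               ¬? (≡-dec G₁._≟_ G₂._≟_ (u₁ , u₂) (v₁ , v₂))
               ×-dec ((u₁ G₁.≟ v₁) ⊎-dec G₁.adj? u₁ v₁)
               ×-dec ((u₂ G₂.≟ v₂) ⊎-dec G₂.adj? u₂ v₂)
  ; symm   = λ (u≢v , a₁ , a₂) → (λ v≡u → u≢v (sym v≡u))
               , Sum.map sym G₁.symm a₁ , Sum.map sym G₂.symm a₂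
  ; irrefl = λ u≡v (u≢v , _) → u≢v u≡v
  }
  where
  module G₁ = Graph G₁
  module G₂ = Graph G₂

≟-swap : ∀ {A : Set} (_≟_ : DecidableEquality A) x y → ⌊ x ≟ y ⌋ ≡ ⌊ y ≟ x ⌋
≟-swap _≟_ x y with x ≟ y | y ≟ x
... | yes _   | yes _   = refl
... | no  _   | no  _   = refl
... | yes x≡y | no  y≢x with () ← y≢x (sym x≡y)
... | no  x≢y | yes y≡x with () ← x≢y (sym y≡x)

horizontal : ∀ G₁ G₂ → Graph.EdgeSet (G₁ ⊠ G₂)
horizontal G₁ G₂ = record
  { member = λ e → ⌊ proj₁ (src e) ≟ proj₁ (tgt e) ⌋
  ; resp   = λ
    { (inj₁ (refl , refl)) → refl
    ; {e} (inj₂ (refl , refl)) → ≟-swap _≟_ (proj₁ (src e)) (proj₁ (tgt e))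
    }
  }
  where
  open Graph (G₁ ⊠ G₂) using (src; tgt)
  open Graph G₁ using (_≟_)

data Sort : Set where
  vertex edge vertexSet edgeSet : Sort

Context : Set
Context = List Sort

infix  7 _≐_ _∈ⱽ_ _∈ᴱ_
infixr 6 _∧_
infixr 5 _∨_
infixr 4 _⇒_

-- Formulas with free variables in Γ, variables being de Bruijn indices.
data Formula (Γ : Context) : Set where
  _≐_  : ∀ {s} → s ∈ Γ → s ∈ Γ → Formula Γ
  _∈ⱽ_ : vertex ∈ Γ → vertexSet ∈ Γ → Formula Γ
  _∈ᴱ_ : edge ∈ Γ → edgeSet ∈ Γ → Formula Γ
  inc  : edge ∈ Γ → vertex ∈ Γ → Formula Γ
  ⊥′   : Formula Γ
  _∧_ _∨_ _⇒_ : Formula Γ → Formula Γ → Formula Γ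
  all′ ex′    : ∀ s → Formula (s ∷ Γ) → Formula Γ

module Semantics (G : Graph) where
  open Graph G

  ⟦_⟧ : Sort → Set
  ⟦ vertex    ⟧ = V
  ⟦ edge      ⟧ = Edge
  ⟦ vertexSet ⟧ = V → Bool
  ⟦ edgeSet   ⟧ = EdgeSet

  Equal : ∀ s → ⟦ s ⟧ → ⟦ s ⟧ → Set
  Equal vertex    u v = u ≡ v
  Equal edge      e f = e ≈ᴱ f
  Equal vertexSet X Y = ∀ v → X v ≡ Y v
  Equal edgeSet   X Y = ∀ e → member X e ≡ member Y e

  Env : Context → Set
  Env = All ⟦_⟧

  Sat : ∀ {Γ} → Env Γ → Formula Γ → Set
  Sat ρ (_≐_ {s} x y) = Equal s (lookup ρ x) (lookup ρ y)
  Sat ρ (x ∈ⱽ X)      = T (lookup ρ X (lookup ρ x))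
  Sat ρ (e ∈ᴱ X)      = T (member (lookup ρ X) (lookup ρ e))
  Sat ρ (inc e v)     = Incident (lookup ρ e) (lookup ρ v)
  Sat ρ ⊥′            = ⊥
  Sat ρ (φ ∧ ψ)       = Sat ρ φ × Sat ρ ψ
  Sat ρ (φ ∨ ψ)       = Sat ρ φ ⊎ Sat ρ ψ
  Sat ρ (φ ⇒ ψ)       = Sat ρ φ → Sat ρ ψ
  Sat ρ (all′ s φ)    = (x : ⟦ s ⟧) → Sat (x ∷ ρ) φ
  Sat ρ (ex′ s φ)     = Σ ⟦ s ⟧ λ x → Sat (x ∷ ρ) φ

infix 3 _,_⊨_

_,_⊨_ : (G : Graph) → Graph.EdgeSet G → Formula (edgeSet ∷ []) → Set
G , H ⊨ φ = Semantics.Sat G (H ∷ []) φ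

{-# OPTIONS --safe #-}

-- Root the tree T, and let cp u v be the depth at which the paths from the root
-- to the leaves u and v part. The ultrametric cp determines which leaves are
-- within distance k, as their distance is cp u u + cp v v − 2 cp u v, and the
-- tree can be rebuilt from cp. For u and v adjacent in the leaf power G, the
-- numbers lab u v = cp u u − cp u v are positive and lab u v + lab v u ≤ k, so
-- they are labels of the edges of G from a set whose size depends on k only, and
-- these can be coded by k sets of edges of G ⊠ C_k. What remains to be found are
-- conditions on labels, expressible in MSO₂, under which they come from some cp:
-- they say that the labels fit together on triangles, that induced paths on
-- three vertices have ends at distance more than k, and that each nonempty set
-- of vertices has a member that is deepest among its neighbours in the set, by
-- comparison of labels. The last condition yields an order in which the vertices
-- can be inserted as leaves, each one attached at the place that its nearest
-- older neighbour dictates, and all other distances then come out right.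

module Submission where

open import Defs
open import Data.Bool using (Bool; T)
open import Data.Bool.Properties using (T?)
open import Data.Empty using (⊥; ⊥-elim)
open import Data.Fin using (Fin; zero; suc; toℕ; fromℕ<; inject₁)
open import Data.Fin.Induction using (<-weakInduction)
open import Data.Fin.Properties using (toℕ-fromℕ<; toℕ-inject₁; any?) renaming (_≟_ to _≟ᶠ_)
import Data.List as List
open import Data.List
  using (List; []; _∷_; _∷ʳ_; _++_; lookup; filter; allFin; map; reverse; replicate; upTo; concatMap)
import Data.List.Membership.DecPropositional as DecMembership
open import Data.List.Membership.Propositional using (_∈_; lose; find)
open import Data.List.Membership.Propositional.Properties
  using ( ∈-filter⁺; ∈-filter⁻; ∈-map⁺; ∈-map⁻; ∈-upTo⁺; ∈-upTo⁻; ∈-concatMap⁺; ∈-concatMap⁻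
        ; ∈-allFin; ∈-lookup)
open import Data.List.Properties
  using (filter-notAll; ∷-injectiveˡ; unfold-reverse; reverse-injective; length-++)
open import Data.List.Relation.Binary.Subset.Propositional using (_⊆_)
open import Data.List.Relation.Unary.All as All using (All)
open import Data.List.Relation.Unary.AllPairs as AllPairs using (AllPairs)
open import Data.List.Relation.Unary.Any as Any using (Any; here; there; index)
open import Data.List.Relation.Unary.Any.Properties using (lookup-index)
open import Data.Nat using (ℕ; zero; suc; _+_; _≤_; _<_; _≥_; _⊓_; _∸_; z≤n; s≤s)
import Data.Nat.Properties as ℕ
open import Data.Nat.Properties hiding (_≟_)
open import Data.Nat.Tactic.RingSolver using (solve)
open import Data.Product using (Σ; ∃; ∃-syntax; _×_; _,_; proj₁; proj₂)
open import Data.Product.Function.NonDependent.Propositional using (_×-⇔_)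
open import Data.Sum using (_⊎_; inj₁; inj₂)
import Data.Sum as Sum
open import Data.Unit using (⊤)
open import Function using (_∘_; id)
open import Function.Bundles using (_⇔_; mk⇔; Inverse; Equivalence)
open import Function.Construct.Identity using (↔-id)
open import Function.Properties.Equivalence using () renaming (trans to ⇔-trans; refl to ⇔-refl)
open import Function.Related.TypeIsomorphisms using (→-cong-⇔)
open import Level using (0ℓ)
open import Relation.Binary.Construct.Closure.ReflexiveTransitive using (ε; _◅_; _◅◅_)
open import Relation.Binary.Core using (Rel)
open import Relation.Binary.Definitions using (Total; Transitive; DecidableEquality)
open import Relation.Binary.PropositionalEquality
open import Relation.Nullary using (¬_; Dec; yes; no; contradiction)
open import Relation.Nullary.Decidable using (⌊_⌋; ¬?; _×-dec_; _⊎-dec_; toWitness; fromWitness)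
open import Relation.Unary using (Pred; Decidable)

-- The obstacle is that a formula can quantify neither over trees nor over depths, which are
-- unbounded. Labels give depth differences along edges of G, and such differences need not add up
-- to zero around a long cycle, which no condition on boundedly many vertices detects. On triangles
-- the sum can be demanded outright, and this is enough when G is chordal. Chordality has no formula
-- of its own here: on a chordless cycle with at least four vertices, a member that is deepest among
-- its neighbours would have two nonadjacent neighbours at distance at most k, against the condition
-- on induced paths. The quantifier over sets in the last condition thus supplies a perfect
-- elimination order. The label of an edge depends on its direction, and G alone does not tell the
-- two directions apart; the layers of the product do. A leaf has exactly one neighbour, so no tree
-- has exactly one leaf and the one-vertex graph is not a leaf power. A separate clause of the
-- formula excludes it.

infixr 5 _⊕_
_⊕_ : ∀ {a b c d} → a ≤ b → c ≤ d → a + c ≤ b + d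
_⊕_ = +-mono-≤

-- Linear arithmetic: the inequality x ≤ y is a sum of hypotheses.
≤-by : ∀ {a b x y} → x ≤ y → a + y ≡ x + b → a ≤ b
≤-by {a} {b} {x} {y} x≤y eq = +-cancelʳ-≤ y a b (begin
  a + y ≡⟨ eq ⟩
  x + b ≤⟨ +-monoˡ-≤ b x≤y ⟩
  y + b ≡⟨ +-comm y b ⟩
  b + y ∎)
  where open ≤-Reasoning

≤-absurd : ∀ {x y} {A : Set} → x ≤ y → x ≡ suc y → A
≤-absurd x≤y refl = ⊥-elim (<-irrefl refl x≤y)

-- A new leaf v is attached at depth base on the way to an old leaf p, and w is
-- another old leaf: P and W are the depths of p and w, and y is the depth at
-- which they part; a, b, c, d, e and f are the labels of the ordered pairs vp,
-- pv, pw, wp, vw and wv.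
module _ {base P W y a b c d : ℕ}
         (p₁ : base + b ≡ P) (p₂ : y + c ≡ P) (w : y + d ≡ W) where

  private
    P≤ = ≤-reflexive p₁
    P≥ = ≤-reflexive (sym p₁)
    Q≤ = ≤-reflexive p₂
    Q≥ = ≤-reflexive (sym p₂)
    W≤ = ≤-reflexive w
    W≥ = ≤-reflexive (sym w)

  -- Both b and c are measured upwards from p. If `c ≤ b`, then base is at most y, v parts from w
  -- where it leaves the path to p, and e must equal a; otherwise y is at most base, w parts from v
  -- where it parts from p, and f must equal d. In either case the cocycle equation yields the other
  -- label.
  insert-adjacent : ∀ {e f} → a ≤ e → a + c + f ≡ b + d + e → e ≤ a ⊎ f ≤ d → c ≤ b ⊎ d ≤ f →
    (base ⊓ y) + e ≡ base + a × (base ⊓ y) + f ≡ W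
  insert-adjacent {e} {f} a≤e eq₀ s t = go t
    where
    eq≤ = ≤-reflexive eq₀
    eq≥ = ≤-reflexive (sym eq₀)

    small : c ≤ b → (base ⊓ y) + e ≡ base + a × (base ⊓ y) + f ≡ W
    small c≤b = trans (cong (_+ e) min) (cong (base +_) (≤-antisym e≤a a≤e))
              , trans (cong (_+ f) min)
                  (≤-antisym
                    (≤-by (P≤ ⊕ Q≥ ⊕ W≤ ⊕ eq≤ ⊕ e≤a) (solve (base ∷ b ∷ P ∷ y ∷ c ∷ d ∷ W ∷ a ∷ e ∷ f ∷ [])))
                    (≤-by (P≥ ⊕ Q≤ ⊕ W≥ ⊕ eq≥ ⊕ a≤e) (solve (base ∷ b ∷ P ∷ y ∷ c ∷ d ∷ W ∷ a ∷ e ∷ f ∷ []))))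
      where
      min : base ⊓ y ≡ base
      min = m≤n⇒m⊓n≡m (≤-by (P≤ ⊕ Q≥ ⊕ c≤b) (solve (base ∷ b ∷ P ∷ y ∷ c ∷ [])))
      from : e ≤ a ⊎ f ≤ d → e ≤ a
      from (inj₁ e≤a) = e≤a
      from (inj₂ f≤d) = ≤-by (eq≥ ⊕ f≤d ⊕ c≤b) (solve (a ∷ b ∷ c ∷ d ∷ e ∷ f ∷ []))
      e≤a : e ≤ a
      e≤a = from s

    go : c ≤ b ⊎ d ≤ f → (base ⊓ y) + e ≡ base + a × (base ⊓ y) + f ≡ W
    go (inj₁ c≤b) = small c≤b
    go (inj₂ d≤f) with ≤-total c b
    ... | inj₁ c≤b = small c≤b
    ... | inj₂ b≤c =
        trans (cong (_+ e) min)
          (≤-antisym (≤-by (P≥ ⊕ Q≤ ⊕ eq≥ ⊕ f≤d) (solve (base ∷ b ∷ P ∷ y ∷ c ∷ d ∷ a ∷ e ∷ f ∷ [])))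
                     (≤-by (P≤ ⊕ Q≥ ⊕ eq≤ ⊕ d≤f) (solve (base ∷ b ∷ P ∷ y ∷ c ∷ d ∷ a ∷ e ∷ f ∷ []))))
      , trans (cong (_+ f) min) (trans (cong (y +_) (≤-antisym f≤d d≤f)) w)
      where
      from : e ≤ a ⊎ f ≤ d → f ≤ d
      from (inj₁ e≤a) = ≤-by (eq≤ ⊕ e≤a ⊕ b≤c) (solve (a ∷ b ∷ c ∷ d ∷ e ∷ f ∷ []))
      from (inj₂ f≤d) = f≤d
      f≤d : f ≤ d
      f≤d = from s
      min : base ⊓ y ≡ y
      min = m≥n⇒m⊓n≡n (≤-by (P≥ ⊕ Q≤ ⊕ b≤c) (solve (base ∷ b ∷ P ∷ y ∷ c ∷ [])))

  -- The alternatives say that parting at depth base, respectively at depth y, would already put v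
  -- and w more than k apart. As m is at most both, so does parting at depth m.
  insert-far : ∀ {k m} → m ≤ base → m ≤ y → k + c < a + b + d ⊎ k + b < a + c + d →
    k + (m + m) < base + a + W
  insert-far {k} {m} m≤base m≤y (inj₁ l) =
    ≤-by (l ⊕ m≤base ⊕ m≤base ⊕ P≤ ⊕ Q≥ ⊕ W≤)
         (solve (k ∷ m ∷ base ∷ b ∷ P ∷ y ∷ c ∷ d ∷ W ∷ a ∷ []))
  insert-far {k} {m} m≤base m≤y (inj₂ l) =
    ≤-by (l ⊕ m≤y ⊕ m≤y ⊕ P≥ ⊕ Q≤ ⊕ W≤)
         (solve (k ∷ m ∷ base ∷ b ∷ P ∷ y ∷ c ∷ d ∷ W ∷ a ∷ []))

-- By `b ≤ a` the new leaf is at least as deep as p, and by `m ≤ y` it parts from w no deeper than p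
-- does, so it is at least as far from w as p is.
insert-beyond : ∀ {k m base P W y a b} → base + b ≡ P → b ≤ a → m ≤ y → k + (y + y) < P + W →
  k + (m + m) < base + a + W
insert-beyond {k} {m} {base} {P} {W} {y} {a} {b} p₁ b≤a m≤y l =
  ≤-by (l ⊕ m≤y ⊕ m≤y ⊕ ≤-reflexive (sym p₁) ⊕ b≤a)
       (solve (k ∷ m ∷ base ∷ P ∷ W ∷ y ∷ a ∷ b ∷ []))

-- If v is at least as deep as its neighbours p and w, then p and w are no farther apart than the
-- larger of their distances to v, hence adjacent. So the older neighbours of an inserted vertex
-- form a clique.
no-far : ∀ {k a b e f} {A : Set} → a + b ≤ k → e + f ≤ k → b ≤ a → f ≤ e →
  k + e < b + a + f ⊎ k + a < b + e + f → A
no-far {k} {a} {b} {e} {f} ab ef b≤a f≤e (inj₁ l) =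
  ≤-absurd (l ⊕ ab ⊕ f≤e) (solve (k ∷ a ∷ b ∷ e ∷ f ∷ []))
no-far {k} {a} {b} {e} {f} ab ef b≤a f≤e (inj₂ l) =
  ≤-absurd (l ⊕ ef ⊕ b≤a) (solve (k ∷ a ∷ b ∷ e ∷ f ∷ []))

close-distance : ∀ {k x y c a b} → x ≡ c + a → y ≡ c + b → a + b ≤ k → x + y ≤ k + (c + c)
close-distance {k} {c = c} {a} {b} refl refl ab = ≤-by ab (solve (k ∷ c ∷ a ∷ b ∷ []))

bound-down : ∀ {X W C C′} L Y → X ≡ suc W → C ≤ C′ → W + Y ≤ L + (C + C) → X + Y ≤ suc L + (C′ + C′)
bound-down {W = W} {C} {C′} L Y refl c le =
  ≤-by (le ⊕ c ⊕ c) (solve (W ∷ C ∷ C′ ∷ L ∷ Y ∷ []))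

bound-up : ∀ {X W C C′} L Y → W ≡ suc X → C ≤ suc C′ → W + Y ≤ L + (C + C) → X + Y ≤ suc L + (C′ + C′)
bound-up {X} {C = C} {C′} L Y refl c le =
  ≤-by (le ⊕ c ⊕ c) (solve (X ∷ C ∷ C′ ∷ L ∷ Y ∷ []))

bound-climb : ∀ {X Z C C′} L Y → X ≡ suc Z → C ≤ C′ → L + (C′ + C′) ≤ Z + Y → suc L + (C + C) ≤ X + Y
bound-climb {Z = Z} {C} {C′} L Y refl c le =
  ≤-by (le ⊕ c ⊕ c) (solve (Z ∷ C ∷ C′ ∷ L ∷ Y ∷ []))

bound-climb′ : ∀ {X Z C C′ M} L Y →
  X ≡ suc Z → C ≤ C′ → L + (C′ + C′) ≤ Y + Z → M ≡ L + 1 → M + (C + C) ≤ Y + X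
bound-climb′ {Z = Z} {C} {C′} L Y refl c le refl =
  ≤-by (le ⊕ c ⊕ c) (solve (Z ∷ C ∷ C′ ∷ L ∷ Y ∷ []))

-- Optimal elements and elimination orders.

module _ {_≲_ : Rel ℕ 0ℓ} (total : Total _≲_) (≲-trans : Transitive _≲_) where

  private
    ≲-refl : ∀ {x} → x ≲ x
    ≲-refl {x} = Sum.[ id , id ]′ (total x x)

  optimum : ∀ {n} {P : Pred (Fin n) 0ℓ} → Decidable P → (g : Fin n → ℕ) →
    (∀ i → ¬ P i) ⊎ (∃[ i ] P i × (∀ j → P j → g i ≲ g j))
  optimum {zero} P? g = inj₁ λ ()
  optimum {suc n} P? g with P? zero | optimum (P? ∘ suc) (g ∘ suc)
  ... | no ¬p | inj₁ none = inj₁ λ { zero → ¬p ; (suc i) → none i }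
  ... | no ¬p | inj₂ (i , pi , best) =
    inj₂ (suc i , pi , λ { zero p → contradiction p ¬p ; (suc j) → best j })
  ... | yes p | inj₁ none =
    inj₂ (zero , p , λ { zero _ → ≲-refl ; (suc j) pj → contradiction pj (none j) })
  ... | yes p | inj₂ (i , pi , best) with total (g zero) (g (suc i))
  ...   | inj₁ le = inj₂ (zero , p , λ { zero _ → ≲-refl ; (suc j) pj → ≲-trans le (best j pj) })
  ...   | inj₂ ge = inj₂ (suc i , pi , λ { zero _ → ge ; (suc j) → best j })

module _ (G : Graph) where
  open Graph G

  private
    module F = Inverse finite

  optimumⱽ : ∀ {_≲_ : Rel ℕ 0ℓ} → Total _≲_ → Transitive _≲_ →
    {P : Pred V 0ℓ} → Decidable P → (g : V → ℕ) →
    (∀ v → ¬ P v) ⊎ (∃[ v ] P v × (∀ w → P w → g v ≲ g w))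
  optimumⱽ {_≲_} total ≲-trans {P} P? g with optimum total ≲-trans (P? ∘ F.from) (g ∘ F.from)
  ... | inj₁ none = inj₁ λ v p → none (F.to v) (subst P (sym (F.strictlyInverseʳ v)) p)
  ... | inj₂ (i , p , best) = inj₂ (F.from i , p , λ w q →
    subst (λ w′ → g (F.from i) ≲ g w′) (F.strictlyInverseʳ w)
      (best (F.to w) (subst P (sym (F.strictlyInverseʳ w)) q)))

  anyⱽ? : {P : Pred V 0ℓ} → Decidable P → Dec (∃ P)
  anyⱽ? P? with optimumⱽ ≤-total ≤-trans P? (λ _ → 0)
  ... | inj₁ none        = no λ (v , p) → none v p
  ... | inj₂ (v , p , _) = yes (v , p)

  enumeration : List V
  enumeration = map F.from (allFin order)

  enumerated : ∀ v → v ∈ enumeration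
  enumerated v = subst (_∈ enumeration) (F.strictlyInverseʳ v) (∈-map⁺ F.from (∈-allFin (F.to v)))

  open DecMembership _≟_ using (_∈?_)

  -- The hypothesis is applied to the set of vertices that remain, the vertex found is removed, and
  -- so on. The head of `xs` is removed first, so a recursion on `xs` inserts its vertices from the
  -- last to the first.
  eliminationOrder : {R : Rel V 0ℓ} →
    (∀ X → ∃[ u ] T (X u) → ∃[ v ] T (X v) × (∀ a → T (X a) → R v a)) →
    ∃[ xs ] AllPairs (λ v a → v ≢ a × R v a) xs × (∀ v → v ∈ xs)
  eliminationOrder {R} elim = xs , ordered , λ v → complete (enumerated v)
    where
    go : ∀ n (zs : List V) → List.length zs ≤ n →
      ∃[ xs ] AllPairs (λ v a → v ≢ a × R v a) xs × (∀ {v} → v ∈ zs → v ∈ xs) × (∀ {v} → v ∈ xs → v ∈ zs)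
    go n [] _ = [] , AllPairs.[] , id , id
    go (suc n) zs@(z ∷ _) len
      with v , Xv , low ← elim (λ u → ⌊ u ∈? zs ⌋) (z , fromWitness (here refl))
      with xs , ord , ⊆xs , xs⊆ ← go n (filter (¬? ∘ (v ≟_)) zs)
             (≤-pred (≤-trans (filter-notAll (¬? ∘ (v ≟_)) zs
               (Any.map (λ v≡z v≢z → v≢z v≡z) (toWitness Xv))) len))
      = v ∷ xs
      , All.tabulate (λ a∈xs → let a∈zs , v≢a = ∈-filter⁻ (¬? ∘ (v ≟_)) {xs = zs} (xs⊆ a∈xs)
                               in v≢a , low _ (fromWitness a∈zs)) AllPairs.∷ ord
      , forward , backward
      where
      forward : ∀ {w} → w ∈ zs → w ∈ v ∷ xs
      forward {w} w∈zs with v ≟ w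
      ... | yes refl = here refl
      ... | no v≢w   = there (⊆xs (∈-filter⁺ (¬? ∘ (v ≟_)) w∈zs v≢w))
      backward : ∀ {w} → w ∈ v ∷ xs → w ∈ zs
      backward (here refl)  = toWitness Xv
      backward (there w∈xs) = proj₁ (∈-filter⁻ (¬? ∘ (v ≟_)) {xs = zs} (xs⊆ w∈xs))

    result = go _ enumeration ≤-refl
    xs = proj₁ result
    ordered = proj₁ (proj₂ result)
    complete = proj₁ (proj₂ (proj₂ result))

-- Addressings and labellings.

-- cp u v stands for the depth at which the paths from the root of a tree to
-- the leaves u and v part, so that cp u u is the depth of u.
record IsAddressing (k : ℕ) (G : Graph) (cp : Graph.V G → Graph.V G → ℕ) : Set where
  open Graph G
  field
    cp-sym   : ∀ u v → cp u v ≡ cp v u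
    cp-ultra : ∀ u v w → cp u v ≤ cp u w ⊎ cp v w ≤ cp u w
    cp-sep   : ∀ {u v} → u ≢ v → cp u v < cp u u
    cp-adj   : ∀ {u v} → u ≢ v → Adj u v ⇔ cp u u + cp v v ≤ k + (cp u v + cp u v)

-- lab u v stands for cp u u ∸ cp u v, and matters for adjacent u and v only.
record IsLabelling (k : ℕ) (G : Graph) (lab : Graph.V G → Graph.V G → ℕ) : Set where
  open Graph G
  field
    lab-pos : ∀ {u v} → Adj u v → 1 ≤ lab u v
    lab-sum : ∀ {u v} → Adj u v → lab u v + lab v u ≤ k
    -- The depth differences `lab v p` - `lab p v` add up to zero around the triangle; the
    -- alternative is the ultrametric inequality for `cp v w`, read off at v or at w.
    lab-tri : ∀ {v p w} → Adj v p → Adj p w → Adj v w →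
      lab v p + lab p w + lab w v ≡ lab p v + lab w p + lab v w
      × (lab v w ≤ lab v p ⊎ lab w v ≤ lab w p)
    -- The distance of v and w is at most what it would be if they parted where v and p do, or where
    -- p and w do. Each alternative says that one of these two values exceeds k.
    lab-far : ∀ {v p w} → Adj v p → Adj p w → ¬ Adj v w → v ≢ w →
      k + lab p w < lab v p + lab p v + lab w p ⊎ k + lab p v < lab v p + lab p w + lab w p
    lab-elim : ∀ (X : V → Bool) → ∃[ u ] T (X u) →
      ∃[ v ] T (X v) × (∀ a → T (X a) → Adj v a → lab a v ≤ lab v a)

-- From labellings to addressings.

module _ {k : ℕ} {G : Graph} {lab : Graph.V G → Graph.V G → ℕ} (1≤k : 1 ≤ k) (L : IsLabelling k G lab) where
  open Graph G
  open IsLabelling L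

  private
    record Partial {n} (f : Fin n → V) (cp : Fin n → Fin n → ℕ) : Set where
      field
        p-inj   : ∀ {i j} → i ≢ j → f i ≢ f j
        p-sym   : ∀ i j → cp i j ≡ cp j i
        p-ultra : ∀ i j l → cp i j ≤ cp i l ⊎ cp j l ≤ cp i l
        p-sep   : ∀ {i j} → i ≢ j → cp i j < cp i i
        -- This leaves room to go up from a leaf by any label, and it puts leaves that part at depth
        -- 0 more than k apart.
        p-deep  : ∀ i → k ≤ cp i i
        p-adj   : ∀ {i j} → Adj (f i) (f j) → cp i j + lab (f i) (f j) ≡ cp i i
        p-far   : ∀ {i j} → i ≢ j → ¬ Adj (f i) (f j) → k + (cp i j + cp i j) < cp i i + cp j j

    open Partial

    module _ (v : V) {xs : List V} {cp : Fin (List.length xs) → Fin (List.length xs) → ℕ}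
             (P : Partial (lookup xs) cp)
             (v≢ : ∀ i → v ≢ lookup xs i) (ℓ : ℕ) (m : Fin (List.length xs) → ℕ)
             (m-ultra₁ : ∀ i j → m i ≤ m j ⊎ cp i j ≤ m j)
             (m-ultra₂ : ∀ i j → m i ≤ cp i j ⊎ m j ≤ cp i j)
             (m<ℓ : ∀ i → m i < ℓ) (m<cp : ∀ i → m i < cp i i) (k≤ℓ : k ≤ ℓ)
             (m-adj : ∀ i → Adj v (lookup xs i) →
               m i + lab v (lookup xs i) ≡ ℓ × m i + lab (lookup xs i) v ≡ cp i i)
             (m-far : ∀ i → ¬ Adj v (lookup xs i) → k + (m i + m i) < ℓ + cp i i)
             where

      cp⁺ : Fin (suc (List.length xs)) → Fin (suc (List.length xs)) → ℕ
      cp⁺ zero    zero    = ℓ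
      cp⁺ zero    (suc j) = m j
      cp⁺ (suc i) zero    = m i
      cp⁺ (suc i) (suc j) = cp i j

      insert : Partial (lookup (v ∷ xs)) cp⁺
      insert .p-inj {zero}  {zero}  i≢j = contradiction refl i≢j
      insert .p-inj {zero}  {suc j} i≢j = v≢ j
      insert .p-inj {suc i} {zero}  i≢j = v≢ i ∘ sym
      insert .p-inj {suc i} {suc j} i≢j = p-inj P (i≢j ∘ cong suc)
      insert .p-sym zero    zero    = refl
      insert .p-sym zero    (suc j) = refl
      insert .p-sym (suc i) zero    = refl
      insert .p-sym (suc i) (suc j) = p-sym P i j
      insert .p-ultra zero    zero    l       = inj₂ ≤-refl
      insert .p-ultra zero    (suc j) zero    = inj₁ (<⇒≤ (m<ℓ j))
      insert .p-ultra zero    (suc j) (suc l) = m-ultra₁ j l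
      insert .p-ultra (suc i) zero    zero    = inj₁ ≤-refl
      insert .p-ultra (suc i) zero    (suc l) = m-ultra₂ i l
      insert .p-ultra (suc i) (suc j) zero    =
        Sum.swap (Sum.map₂ (subst (_≤ m i) (p-sym P j i)) (m-ultra₁ j i))
      insert .p-ultra (suc i) (suc j) (suc l) = p-ultra P i j l
      insert .p-sep {zero}  {zero}  i≢j = contradiction refl i≢j
      insert .p-sep {zero}  {suc j} i≢j = m<ℓ j
      insert .p-sep {suc i} {zero}  i≢j = m<cp i
      insert .p-sep {suc i} {suc j} i≢j = p-sep P (i≢j ∘ cong suc)
      insert .p-deep zero    = k≤ℓ
      insert .p-deep (suc i) = p-deep P i
      insert .p-adj {zero}  {zero}  a = contradiction a (irrefl refl)
      insert .p-adj {zero}  {suc j} a = proj₁ (m-adj j a)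
      insert .p-adj {suc i} {zero}  a = proj₂ (m-adj i (symm a))
      insert .p-adj {suc i} {suc j} a = p-adj P a
      insert .p-far {zero}  {zero}  i≢j _ = contradiction refl i≢j
      insert .p-far {zero}  {suc j} i≢j ¬a = m-far j ¬a
      insert .p-far {suc i} {zero}  i≢j ¬a =
        subst (k + (m i + m i) <_) (+-comm ℓ (cp i i)) (m-far i (¬a ∘ symm))
      insert .p-far {suc i} {suc j} i≢j ¬a = p-far P (i≢j ∘ cong suc) ¬a

    Order : V → V → Set
    Order v a = v ≢ a × (Adj v a → lab a v ≤ lab v a)

    -- A vertex without older neighbours becomes a leaf of depth k + 1 that parts from all others at
    -- depth 0, and this depth alone exceeds k. In this way the components of a disconnected graph
    -- are joined.
    isolated : ∀ v {xs cp} → Partial (lookup xs) cp → All (Order v) xs → (∀ i → ¬ Adj v (lookup xs i)) →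
      ∃ (Partial (lookup (v ∷ xs)))
    isolated v {xs} {cp} P order none = _ ,
      insert v P (λ i → proj₁ (All.lookup order (∈-lookup i))) (suc k) (λ _ → 0)
      (λ _ _ → inj₁ z≤n) (λ _ _ → inj₁ z≤n) (λ _ → s≤s z≤n)
      (λ i → ≤-trans 1≤k (p-deep P i))
      (n≤1+n k)
      (λ i a → contradiction a (none i))
      (λ i _ → s≤s (≤-trans (≤-reflexive (+-identityʳ k)) (m≤m+n k (cp i i))))

    -- The new leaf hangs on a path of a edges from the ancestor of p that is b edges above p, and
    -- it parts from another leaf i at `base` or where p does, whichever is shallower. If i is
    -- adjacent to p, the conditions on triangles and induced paths apply to v, p and i. If not,
    -- then i is not adjacent to v either, and v is at least as far from i as p is.
    attached : ∀ v {xs cp} → Partial (lookup xs) cp → All (Order v) xs →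
      ∀ p → Adj v (lookup xs p) → (∀ i → Adj v (lookup xs i) → lab v (lookup xs p) ≤ lab v (lookup xs i)) →
      ∃ (Partial (lookup (v ∷ xs)))
    attached v {xs} {cp} P order p v~p nearest = _ , insert v P distinct (base + a) m
      ultra₁ ultra₂ shallow₁ shallow₂ deep near far
      where
      open ≤-Reasoning
      f = lookup xs
      a = lab v (f p)
      b = lab (f p) v
      b≤a : b ≤ a
      b≤a = proj₂ (All.lookup order (∈-lookup p)) v~p
      base = cp p p ∸ b
      base+b : base + b ≡ cp p p
      base+b = m∸n+n≡m (≤-trans (≤-trans (m≤m+n b a) (lab-sum (symm v~p))) (p-deep P p))
      m : Fin (List.length xs) → ℕ
      m i = base ⊓ cp p i

      distinct : ∀ i → v ≢ f i
      distinct i = proj₁ (All.lookup order (∈-lookup i))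

      a≥1 : 1 ≤ a
      a≥1 = lab-pos v~p

      ultra₁ : ∀ i j → m i ≤ m j ⊎ cp i j ≤ m j
      ultra₁ i j with p-ultra P p i j | ≤-total base (cp p j)
      ... | inj₁ pi≤pj | _         = inj₁ (⊓-monoʳ-≤ base pi≤pj)
      ... | inj₂ ij≤pj | inj₁ base≤ = inj₁ (≤-trans (m⊓n≤m base _) (≤-reflexive (sym (m≤n⇒m⊓n≡m base≤))))
      ... | inj₂ ij≤pj | inj₂ ≤base = inj₂ (≤-trans ij≤pj (≤-reflexive (sym (m≥n⇒m⊓n≡n ≤base))))

      m≤cp : ∀ i → m i ≤ cp i p
      m≤cp i = ≤-trans (m⊓n≤n base (cp p i)) (≤-reflexive (p-sym P p i))

      ultra₂ : ∀ i j → m i ≤ cp i j ⊎ m j ≤ cp i j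
      ultra₂ i j = Sum.map (≤-trans (m≤cp i)) (≤-trans (m⊓n≤n base (cp p j))) (p-ultra P i p j)

      shallow₁ : ∀ i → m i < base + a
      shallow₁ i = begin-strict
        m i      ≤⟨ m⊓n≤m base _ ⟩
        base     <⟨ m<m+n base a≥1 ⟩
        base + a ∎

      shallow₂ : ∀ i → m i < cp i i
      shallow₂ i with i ≟ᶠ p
      ... | yes refl = begin-strict
        m p      ≤⟨ m⊓n≤m base _ ⟩
        base     <⟨ m<m+n base (lab-pos (symm v~p)) ⟩
        base + b ≡⟨ base+b ⟩
        cp p p   ∎
      ... | no i≢p = ≤-<-trans (m≤cp i) (p-sep P i≢p)

      deep : k ≤ base + a
      deep = begin
        k        ≤⟨ p-deep P p ⟩
        cp p p   ≡⟨ base+b ⟨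
        base + b ≤⟨ +-monoʳ-≤ base b≤a ⟩
        base + a ∎

      p-adj′ : ∀ {i} → Adj (f p) (f i) → cp p i + lab (f i) (f p) ≡ cp i i
      p-adj′ {i} p~i = trans (cong (_+ lab (f i) (f p)) (p-sym P p i)) (p-adj P (symm p~i))

      near : ∀ i → Adj v (f i) → m i + lab v (f i) ≡ base + a × m i + lab (f i) v ≡ cp i i
      near i v~i with i ≟ᶠ p
      ... | yes refl = cong (_+ a) min , trans (cong (_+ b) min) base+b
        where
        min : base ⊓ cp p p ≡ base
        min = m≤n⇒m⊓n≡m (≤-trans (m≤m+n base b) (≤-reflexive base+b))
      ... | no i≢p with adj? (f p) (f i)
      ...   | yes p~i = insert-adjacent {base} {cp p p} {cp i i} {cp p i} base+b
                (p-adj P p~i) (p-adj′ p~i) (nearest i v~i)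
                (proj₁ (lab-tri v~p p~i v~i))
                (proj₂ (lab-tri v~p p~i v~i))
                (proj₂ (lab-tri (symm v~p) v~i p~i))
      -- The induced path is p, v, i, with the inserted vertex in the middle.
      ...   | no p≁i = no-far (lab-sum v~p) (lab-sum v~i) b≤a
                (proj₂ (All.lookup order (∈-lookup i)) v~i)
                (lab-far (symm v~p) v~i p≁i (p-inj P (λ p≡i → i≢p (sym p≡i))))

      far : ∀ i → ¬ Adj v (f i) → k + (m i + m i) < base + a + cp i i
      far i v≁i with adj? (f p) (f i)
      ... | yes p~i = insert-far {base = base} {cp p p} {cp i i} {cp p i} base+b
              (p-adj P p~i) (p-adj′ p~i) (m⊓n≤m base _) (m⊓n≤n base _)
              (lab-far v~p p~i v≁i (distinct i))
      ... | no p≁i = insert-beyond {k} {m i} {base} {cp p p} {cp i i} {cp p i} base+b b≤a (m⊓n≤n base _)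
              (p-far P (λ { refl → v≁i v~p }) p≁i)

    partialAddressing : ∀ {xs} → AllPairs Order xs → ∃ (Partial (lookup xs))
    partialAddressing AllPairs.[] = (λ ()) , record
      { p-inj = λ { {()} } ; p-sym = λ () ; p-ultra = λ () ; p-sep = λ { {()} }
      ; p-deep = λ () ; p-adj = λ { {()} } ; p-far = λ { {()} } }
    partialAddressing {v ∷ xs} (order AllPairs.∷ orders) with _ , P ← partialAddressing orders
      -- Nearest means least label on the side of v, hence deepest parting from v; the distance
      -- itself need not be least.
      with optimum ≤-total ≤-trans (λ i → adj? v (lookup xs i)) (λ i → lab v (lookup xs i))
    ... | inj₁ none = isolated v P order none
    ... | inj₂ (p , v~p , nearest) = attached v P order p v~p nearest

  addressing : ∃ (IsAddressing k G)
  addressing with xs , ordered , complete ← eliminationOrder G lab-elim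
    with cp , P ← partialAddressing ordered = _ , record
      { cp-sym = λ u v → p-sym P (ix u) (ix v)
      ; cp-ultra = λ u v w → p-ultra P (ix u) (ix v) (ix w)
      ; cp-sep = λ u≢v → p-sep P (u≢v ∘ ix-injective)
      ; cp-adj = λ {u} {v} u≢v → mk⇔ (near u v) (λ le → far le u≢v)
      }
    where
    ix : V → Fin (List.length xs)
    ix v = index (complete v)

    at : ∀ v → lookup xs (ix v) ≡ v
    at v = sym (lookup-index (complete v))

    ix-injective : ∀ {u v} → ix u ≡ ix v → u ≡ v
    ix-injective {u} {v} eq = trans (sym (at u)) (trans (cong (lookup xs) eq) (at v))

    near : ∀ u v → Adj u v → cp (ix u) (ix u) + cp (ix v) (ix v) ≤ k + (cp (ix u) (ix v) + cp (ix u) (ix v))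
    near u v u~v = close-distance {c = cp (ix u) (ix v)} {lab (lookup xs (ix u)) (lookup xs (ix v))}
      (sym (p-adj P u~v′))
      (trans (sym (p-adj P (symm u~v′)))
        (cong (_+ lab (lookup xs (ix v)) (lookup xs (ix u))) (p-sym P (ix v) (ix u))))
      (lab-sum u~v′)
      where
      u~v′ : Adj (lookup xs (ix u)) (lookup xs (ix v))
      u~v′ = subst₂ Adj (sym (at u)) (sym (at v)) u~v

    far : ∀ {u v} → cp (ix u) (ix u) + cp (ix v) (ix v) ≤ k + (cp (ix u) (ix v) + cp (ix u) (ix v)) →
      u ≢ v → Adj u v
    far {u} {v} le u≢v with adj? u v
    ... | yes u~v = u~v
    ... | no u≁v = contradiction le (<⇒≱ (p-far P (u≢v ∘ ix-injective) (u≁v ∘ subst₂ Adj (at u) (at v))))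

-- From addressings to labellings.

module _ {V P W a b c d e f x y z : ℕ}
         (v₁ : x + a ≡ V) (p₁ : x + b ≡ P) (p₂ : y + c ≡ P) (w₁ : y + d ≡ W)
         (v₂ : z + e ≡ V) (w₂ : z + f ≡ W) where

  private
    v≤ = ≤-reflexive (trans v₁ (sym v₂))
    v≥ = ≤-reflexive (trans v₂ (sym v₁))
    p≤ = ≤-reflexive (trans p₁ (sym p₂))
    p≥ = ≤-reflexive (trans p₂ (sym p₁))
    w≤ = ≤-reflexive (trans w₁ (sym w₂))
    w≥ = ≤-reflexive (trans w₂ (sym w₁))

  depths-cocycle : a + c + f ≡ b + d + e
  depths-cocycle = ≤-antisym
    (≤-by (v≤ ⊕ p≥ ⊕ w≥) (solve (a ∷ b ∷ c ∷ d ∷ e ∷ f ∷ x ∷ y ∷ z ∷ [])))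
    (≤-by (v≥ ⊕ p≤ ⊕ w≤) (solve (a ∷ b ∷ c ∷ d ∷ e ∷ f ∷ x ∷ y ∷ z ∷ [])))

  depths-ultra : x ≤ z ⊎ y ≤ z → e ≤ a ⊎ f ≤ d
  depths-ultra (inj₁ x≤z) = inj₁ (≤-by (v≥ ⊕ x≤z) (solve (a ∷ e ∷ x ∷ z ∷ [])))
  depths-ultra (inj₂ y≤z) = inj₂ (≤-by (w≥ ⊕ y≤z) (solve (d ∷ f ∷ y ∷ z ∷ [])))

-- Replacing z by the smaller x or y only increases V + W - 2z, and equating the two expressions for
-- P then removes all depths.
depths-far : ∀ {k V P W a b c d x y z} → x + a ≡ V → x + b ≡ P → y + c ≡ P → y + d ≡ W →
  x ≤ z ⊎ y ≤ z → k + (z + z) < V + W → k + c < a + b + d ⊎ k + b < a + c + d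
depths-far {k} {a = a} {b} {c} {d} {x} {y} {z} refl p₁ p₂ refl (inj₁ x≤z) far =
  inj₁ (≤-by (far ⊕ x≤z ⊕ x≤z ⊕ ≤-reflexive (trans p₂ (sym p₁)))
             (solve (k ∷ a ∷ b ∷ c ∷ d ∷ x ∷ y ∷ z ∷ [])))
depths-far {k} {a = a} {b} {c} {d} {x} {y} {z} refl p₁ p₂ refl (inj₂ y≤z) far =
  inj₂ (≤-by (far ⊕ y≤z ⊕ y≤z ⊕ ≤-reflexive (trans p₁ (sym p₂)))
             (solve (k ∷ a ∷ b ∷ c ∷ d ∷ x ∷ y ∷ z ∷ [])))

depths-sum : ∀ {k a b x V W} → x + a ≡ V → x + b ≡ W → V + W ≤ k + (x + x) → a + b ≤ k
depths-sum {k} {a} {b} {x} refl refl le = ≤-by le (solve (k ∷ a ∷ b ∷ x ∷ []))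

depths-elim : ∀ {a b x V W} → x + a ≡ V → x + b ≡ W → V ≤ W → a ≤ b
depths-elim {a} {b} {x} refl refl le = +-cancelˡ-≤ x a b le

module _ {k : ℕ} {G : Graph} {cp : Graph.V G → Graph.V G → ℕ} (A : IsAddressing k G cp) where
  open Graph G
  open IsAddressing A

  private
    lab : V → V → ℕ
    lab u v = cp u u ∸ cp u v

    adj⇒≢ : ∀ {u v} → Adj u v → u ≢ v
    adj⇒≢ u~v refl = irrefl refl u~v

    left : ∀ {u v} → Adj u v → cp u v + lab u v ≡ cp u u
    left u~v = m+[n∸m]≡n (<⇒≤ (cp-sep (adj⇒≢ u~v)))

    right : ∀ {u v} → Adj u v → cp u v + lab v u ≡ cp v v
    right {u} {v} u~v = trans (cong (_+ lab v u) (cp-sym u v)) (left (symm u~v))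

    elim : ∀ (X : V → Bool) → ∃[ u ] T (X u) →
      ∃[ v ] T (X v) × (∀ a → T (X a) → Adj v a → lab a v ≤ lab v a)
    -- A deepest vertex of X will do, since the two labels of an edge differ by as much as the
    -- depths of its ends.
    elim X (u , Xu) with optimumⱽ G {_≥_} (λ m n → ≤-total n m) (λ p q → ≤-trans q p) (T? ∘ X) (λ v → cp v v)
    ... | inj₁ none = contradiction Xu (none u)
    ... | inj₂ (v , Xv , max) = v , Xv , λ a Xa v~a → depths-elim (right v~a) (left v~a) (max a Xa)

  labelling : ∃ (IsLabelling k G)
  labelling = lab , record
    { lab-pos = λ u~v → m<n⇒0<n∸m (cp-sep (adj⇒≢ u~v))
    ; lab-sum = λ {u} {v} u~v →
        depths-sum {x = cp u v} (left u~v) (right u~v) (Equivalence.to (cp-adj (adj⇒≢ u~v)) u~v)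
    ; lab-tri = λ {v} {p} {w} v~p p~w v~w →
        depths-cocycle {x = cp v p} {y = cp p w} {z = cp v w}
            (left v~p) (right v~p) (left p~w) (right p~w) (left v~w) (right v~w)
         , depths-ultra {x = cp v p} {y = cp p w} {z = cp v w}
            (left v~p) (right v~p) (left p~w) (right p~w) (left v~w) (right v~w)
            (cp-ultra v p w)
    ; lab-far = λ {v} {p} {w} v~p p~w v≁w v≢w →
        depths-far {x = cp v p} {y = cp p w} {z = cp v w}
          (left v~p) (right v~p) (left p~w) (right p~w) (cp-ultra v p w)
          (≰⇒> (v≁w ∘ Equivalence.from (cp-adj v≢w)))
    ; lab-elim = elim
    }

-- Walks and paths.

module _ (G : Graph) where
  open Graph G
  open DecMembership _≟_ using (_∈?_)

  length-◅◅ : ∀ {u v w} (p : Walk u v) (q : Walk v w) → length (p ◅◅ q) ≡ length p + length q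
  length-◅◅ ε       q = refl
  length-◅◅ (_ ◅ p) q = cong suc (length-◅◅ p q)

  source∈ : ∀ {u v} (p : Walk u v) → u ∈ vertices p
  source∈ ε       = here refl
  source∈ (_ ◅ _) = here refl

  target∈ : ∀ {u v} (p : Walk u v) → v ∈ vertices p
  target∈ ε       = here refl
  target∈ (_ ◅ p) = there (target∈ p)

  pathFrom : ∀ {u v w} (p : Walk u v) → IsPath p → w ∈ vertices p →
    ∃[ q ] IsPath {w} {v} q × vertices q ⊆ vertices p × length q ≤ length p
           × (w ≢ u → length q < length p)
  pathFrom ε       path (here refl) = ε , path , id , z≤n , λ w≢w → contradiction refl w≢w
  pathFrom (a ◅ p) path (here refl) = (a ◅ p) , path , id , ≤-refl , λ w≢w → contradiction refl w≢w
  pathFrom (a ◅ p) (_ AllPairs.∷ path) (there w∈p) with q , path′ , q⊆p , q≤p , _ ← pathFrom p path w∈p =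
    q , path′ , there ∘ q⊆p , m≤n⇒m≤1+n q≤p , λ _ → s≤s q≤p

  toPath : ∀ {u v} (p : Walk u v) →
    ∃[ q ] IsPath {u} {v} q × vertices q ⊆ vertices p × length q ≤ length p
  toPath ε = ε , All.[] AllPairs.∷ AllPairs.[] , id , z≤n
  toPath {u} (a ◅ p) with q , path , q⊆p , q≤p ← toPath p with u ∈? vertices q
  ... | no u∉q = (a ◅ q) , All.tabulate (λ w∈q u≡w → u∉q (subst (_∈ vertices q) (sym u≡w) w∈q)) AllPairs.∷ path
               , (λ { (here eq) → here eq ; (there w∈q) → there (q⊆p w∈q) }) , s≤s q≤p
  ... | yes u∈q with q′ , path′ , q′⊆q , q′≤q , _ ← pathFrom q path u∈q =
    q′ , path′ , there ∘ q⊆p ∘ q′⊆q , m≤n⇒m≤1+n (≤-trans q′≤q q≤p)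

  source-fresh : ∀ {u v w} (a : Adj u v) (p : Walk v w) → IsPath (a ◅ p) → ∀ {x} → x ∈ vertices p → u ≢ x
  source-fresh a p (fresh AllPairs.∷ _) = All.lookup fresh

-- Trees described by the depths at which paths from the root part.

-- c x y stands for the depth at which the paths from the root to x and y part.
record IsTreeMetric (T : Graph) (root : Graph.V T) (c : Graph.V T → Graph.V T → ℕ) : Set where
  open Graph T

  Child : V → V → Set
  Child x y = c x x ≡ suc (c y y) × c x y ≡ c y y

  field
    c-sym   : ∀ x y → c x y ≡ c y x
    c-ultra : ∀ x y z → c x y ≤ c x z ⊎ c y z ≤ c x z
    c-le    : ∀ x y → c x y ≤ c x x
    c-inj   : ∀ {x y} → c x y ≡ c x x → c x y ≡ c y y → x ≡ y
    c-root  : ∀ x → c root x ≡ c root root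
    up      : ∀ x → x ≢ root → ∃[ y ] Child x y × Adj x y
    split   : ∀ {x y} → Adj x y → Child x y ⊎ Child y x

  parent : ∀ x → x ≢ root → ∃ (Child x)
  parent x x≢r = let y , x↓y , _ = up x x≢r in y , x↓y

  c-le′ : ∀ x y → c x y ≤ c y y
  c-le′ x y = ≤-trans (≤-reflexive (c-sym x y)) (c-le y x)

  -- That is, z is an ancestor of x.
  Below : V → V → Set
  Below z x = c z z ≤ c z x

  antisymmetric : ∀ {x y} → Below x y → c y y ≤ c x x → x ≡ y
  antisymmetric {x} {y} x≤y le = c-inj (≤-antisym (c-le x y) x≤y)
    (≤-antisym (c-le′ x y) (≤-trans le x≤y))

  -- Both y and z are ancestors of x at the same depth, and by the ultrametric inequality they do
  -- not part before that depth.
  parent-unique : ∀ {x y z} → Child x y → Child x z → y ≡ z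
  parent-unique {x} {y} {z} (xy , cxy) (xz , cxz) = antisymmetric
    (Sum.[ (λ le → ≤-trans (≤-reflexive (trans (sym cxy) (c-sym x y))) le)
         , (λ le → ≤-trans (≤-reflexive (trans (suc-injective (trans (sym xy) xz)) (sym cxz))) le)
         ]′ (c-ultra y x z))
    (≤-reflexive (suc-injective (trans (sym xz) xy)))

  -- The parent that `up` provides is adjacent to x, and there is no other.
  child-adj : ∀ {x y} → Child x y → Adj x y
  child-adj {x} {y} x↓y with x ≟ root
  ... | yes refl = contradiction (trans (c-root y) (proj₁ x↓y)) (<⇒≢ (s≤s (c-le′ x y)))
  ... | no x≢r with z , x↓z , x~z ← up x x≢r = subst (Adj x) (parent-unique x↓z x↓y) x~z

  adj⇔ : ∀ x y → Adj x y ⇔ (Child x y ⊎ Child y x)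
  adj⇔ x y = mk⇔ split Sum.[ child-adj , symm ∘ child-adj ]′

  below-child : ∀ {x y z} → Child y x → Below z x → Below z y
  below-child {x} {y} {z} (_ , cyx) z≤x with c-ultra z x y
  ... | inj₁ le = ≤-trans z≤x le
  ... | inj₂ le = ≤-trans (≤-trans z≤x (c-le′ z x)) (≤-trans (≤-reflexive (trans (sym cyx) (c-sym y x))) le)

  -- Leaving the subtree below z means passing through the parent u of z.
  below-step : ∀ {x y z u} → Child z u → Adj x y → y ≢ u → Below z x → Below z y
  below-step {x} {y} {z} {u} (zu , czu) x~y y≢u z≤x with Equivalence.to (adj⇔ x y) x~y
  ... | inj₂ y↓x = below-child y↓x z≤x
  ... | inj₁ (xy , cxy) with c-ultra z x y
  ...   | inj₁ le = ≤-trans z≤x le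
  ...   | inj₂ le with c z z ≤? c z y
  ...     | yes z≤y = z≤y
  ...     | no  z≰y = contradiction (sym (antisymmetric u≤y y≤u)) y≢u
    where
    y≤czy : c y y ≤ c z y
    y≤czy = ≤-trans (≤-reflexive (sym cxy)) le
    y≤u : c y y ≤ c u u
    y≤u = ≤-pred (≤-trans (s≤s y≤czy) (≤-trans (≰⇒> z≰y) (≤-reflexive zu)))
    u≤y′ : c u u ≤ c y y
    u≤y′ = ≤-pred (≤-trans (≤-reflexive (sym zu)) (≤-trans (≤-trans z≤x (c-le′ z x)) (≤-reflexive xy)))
    u≤y : Below u y
    u≤y with c-ultra u z y
    ... | inj₁ le′ = ≤-trans (≤-reflexive (trans (sym czu) (c-sym z u))) le′
    ... | inj₂ le′ = ≤-trans u≤y′ (≤-trans y≤czy le′)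

  below-walk : ∀ {x y z u} → Child z u → (p : Walk x y) → (∀ {w} → w ∈ vertices p → u ≢ w) →
    Below z x ⇔ Below z y
  below-walk z↓u ε avoid = mk⇔ id id
  below-walk z↓u (a ◅ p) avoid = mk⇔
    (λ z≤x → Equivalence.to rest (below-step z↓u a (avoid (there (source∈ T p)) ∘ sym) z≤x))
    (λ z≤y → below-step z↓u (symm a) (avoid (here refl) ∘ sym) (Equivalence.from rest z≤y))
    where
    rest = below-walk z↓u p (avoid ∘ there)

  -- The rest of the cycle, from x to v, avoids u. If x or v is a child of u, the rest stays in the
  -- subtree below that child; but the other one of the two is no deeper, so it can only be the same
  -- vertex or lie outside. If neither is a child of u, both are its parent. Either way a
  -- contradiction results.
  acyclic : Acyclic
  acyclic (_ ◅ ε) _ (s≤s ())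
  acyclic {u} {v} (_◅_ {j = x} a q@(b ◅ q′)) path@(_ AllPairs.∷ path′) _ v~u
    with Equivalence.to (adj⇔ v u) v~u | Equivalence.to (adj⇔ u x) a
  ... | inj₁ v↓u | inj₂ x↓u = x≢v (antisymmetric
          (Equivalence.to (below-walk x↓u q (source-fresh T a q path)) ≤-refl)
          (≤-reflexive (trans (proj₁ v↓u) (sym (proj₁ x↓u)))))
    where x≢v = source-fresh T b q′ path′ (target∈ T q′)
  ... | inj₁ v↓u | inj₁ u↓x = <⇒≱ v>x (≤-trans v≤x (c-le′ v x))
    where
    v≤x : Below v x
    v≤x = Equivalence.from (below-walk v↓u q (source-fresh T a q path)) ≤-refl
    v>x : c x x < c v v
    v>x = ≤-trans (n≤1+n _) (≤-reflexive (sym (trans (proj₁ v↓u) (cong suc (proj₁ u↓x)))))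
  ... | inj₂ u↓v | inj₁ u↓x = source-fresh T b q′ path′ (target∈ T q′) (parent-unique u↓x u↓v)
  ... | inj₂ u↓v | inj₂ x↓u = <⇒≱ x>v (≤-trans x≤v (c-le′ x v))
    where
    x≤v : Below x v
    x≤v = Equivalence.to (below-walk x↓u q (source-fresh T a q path)) ≤-refl
    x>v : c v v < c x x
    x>v = ≤-trans (n≤1+n _) (≤-reflexive (sym (trans (proj₁ x↓u) (cong suc (proj₁ u↓v)))))

  -- For fixed y, the quantity c x x - 2 c x y drops by at most one along an edge.
  walk-bound : ∀ {x y} (p : Walk x y) → c x x + c y y ≤ length p + (c x y + c x y)
  walk-bound ε = ≤-refl
  walk-bound {x} {y} (_◅_ {j = w} a p) with Equivalence.to (adj⇔ x w) a
  ... | inj₁ (xw , cxw) = bound-down (length p) (c y y) xw cw≤cx (walk-bound p)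
    where
    cw≤cx : c w y ≤ c x y
    cw≤cx = Sum.[ (λ le → ≤-trans (c-le w y) (≤-trans (≤-reflexive (sym cxw)) le)) , id ]′ (c-ultra x w y)
  ... | inj₂ (wx , cwx) = bound-up (length p) (c y y) wx cw≤cx (walk-bound p)
    where
    cw≤cx : c w y ≤ suc (c x y)
    cw≤cx with c-ultra x w y
    ... | inj₁ le = ≤-trans (c-le w y) (≤-trans (≤-reflexive wx)
                      (s≤s (≤-trans (≤-reflexive (trans (sym cwx) (c-sym w x))) le)))
    ... | inj₂ le = m≤n⇒m≤1+n le

  toward : ∀ {x y} → c x y < c x x → ∃[ z ] Child x z × c x y ≤ c z y
  toward {x} {y} lt with x ≟ root
  ... | yes refl = contradiction (≤-reflexive (sym (c-root y))) (<⇒≱ lt)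
  ... | no x≢r with z , xz , cxz ← parent x x≢r = z , (xz , cxz) ,
      Sum.[ (λ le → ≤-trans (≤-pred (≤-trans lt (≤-reflexive xz)))
                            (≤-trans (≤-reflexive (trans (sym cxz) (c-sym x z))) le)) , id ]′ (c-ultra z x y)

  -- As long as x is deeper than the place where the paths part, the walk goes to its parent; then
  -- the same is done from the end y, until both ends meet at that place. The number n bounds the
  -- sum of the depths, which each step lowers.
  geodesic : ∀ x y → ∃[ p ] length {x} {y} p + (c x y + c x y) ≤ c x x + c y y
  geodesic x y = go _ x y ≤-refl
    where
    go : ∀ n x y → c x x + c y y ≤ n → ∃[ p ] length {x} {y} p + (c x y + c x y) ≤ c x x + c y y
    go n x y le with suc (c x y) ≤? c x x
    go n x y le | yes lt with z , x↓z , cz ← toward lt with n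
    ... | zero = contradiction (≤-trans lt (≤-trans (m≤m+n _ _) le)) λ ()
    ... | suc n with p , len ← go n z y (≤-pred (≤-trans (≤-reflexive (cong (_+ c y y) (sym (proj₁ x↓z)))) le)) =
      (Equivalence.from (adj⇔ x z) (inj₁ x↓z) ◅ p) , bound-climb (length p) (c y y) (proj₁ x↓z) cz len
    go n x y le | no ≥x with suc (c y x) ≤? c y y
    ... | no ≥y with refl ← antisymmetric {x} {y} (≮⇒≥ ≥x)
                 (≤-trans (≮⇒≥ ≥y) (≤-trans (c-le′ y x) ≤-refl)) = ε , ≤-refl
    ... | yes lt with z , y↓z , cz ← toward lt with n
    ...   | zero = contradiction (≤-trans lt (≤-trans (m≤n+m _ _) le)) λ ()
    ...   | suc n with p , len ← go n x z (≤-pred (≤-trans (≤-reflexive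
                        (trans (sym (+-suc (c x x) (c z z))) (cong (c x x +_) (sym (proj₁ y↓z))))) le)) =
      (p ◅◅ (Equivalence.from (adj⇔ z y) (inj₂ y↓z) ◅ ε)) ,
      bound-climb′ (length p) (c x x) (proj₁ y↓z) (subst₂ _≤_ (c-sym y x) (c-sym z x) cz) len (length-◅◅ T p _)

  connected : Connected
  connected = root , λ x y → let p , _ = geodesic x y ; q , path , _ = toPath T p in q , path

  isTree : IsTree
  isTree = connected , acyclic

  path≤⇔ : ∀ k x y → (∃[ p ] IsPath {x} {y} p × length p ≤ k) ⇔ c x x + c y y ≤ k + (c x y + c x y)
  path≤⇔ k x y = mk⇔
    (λ (p , _ , len) → ≤-trans (walk-bound p) (+-monoˡ-≤ _ len))
    (λ le → let p , len = geodesic x y ; q , path , _ , q≤p = toPath T p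
            in q , path , ≤-trans q≤p (+-cancelʳ-≤ _ _ _ (≤-trans len le)))

  -- Climbing from y, one reaches x through a child of x. Hence a leaf other than the root is not an
  -- ancestor of another vertex, which separates the leaves in an addressing.
  childToward : ∀ x y → Below x y → x ≢ y → ∃[ z ] Child z x
  childToward x y = go _ y ≤-refl
    where
    go : ∀ n y → c y y ≤ n → Below x y → x ≢ y → ∃[ z ] Child z x
    go n y le x≤y x≢y with y ≟ root
    ... | yes refl = contradiction (antisymmetric x≤y (≤-trans (≤-reflexive (sym (c-root x))) (c-le′ y x))) x≢y
    ... | no y≢r with z , y↓z ← parent y y≢r with z ≟ x
    ...   | yes refl = y , y↓z
    ...   | no z≢x with n
    ...     | zero = contradiction (≤-trans (≤-reflexive (sym (proj₁ y↓z))) le) λ ()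
    ...     | suc n = go n z (≤-pred (≤-trans (≤-reflexive (sym (proj₁ y↓z))) le)) x≤z (z≢x ∘ sym)
      where
      x<y : c x x < c y y
      x<y = ≰⇒> (x≢y ∘ antisymmetric x≤y)
      x≤z : Below x z
      x≤z with c-ultra x y z
      ... | inj₁ le = ≤-trans x≤y le
      ... | inj₂ le = ≤-trans (≤-pred (≤-trans x<y (≤-reflexive (proj₁ y↓z))))
                              (≤-trans (≤-reflexive (sym (proj₂ y↓z))) le)

  leaf-childless : ∀ {x} → x ≢ root → Leaf x → ∀ {z} → ¬ Child z x
  leaf-childless {x} x≢r (_ , _ , unique) {z} z↓x with y , x↓y ← parent x x≢r =
    <⇒≢ (≤-trans (≤-trans (n≤1+n (suc (c y y))) (≤-reflexive (cong suc (sym (proj₁ x↓y)))))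
                 (≤-reflexive (sym (proj₁ z↓x))))
        (cong (λ w → c w w) (trans (sym (unique (Equivalence.from (adj⇔ x y) (inj₁ x↓y))))
                                   (unique (Equivalence.from (adj⇔ x z) (inj₂ z↓x)))))

  childless-leaf : ∀ {x} → x ≢ root → (∀ {z} → ¬ Child z x) → Leaf x
  childless-leaf {x} x≢r none with y , x↓y ← parent x x≢r =
    y , Equivalence.from (adj⇔ x y) (inj₁ x↓y) , λ {z} x~z →
      Sum.[ parent-unique x↓y , (λ z↓x → contradiction z↓x none) ]′ (Equivalence.to (adj⇔ x z) x~z)

-- Common prefixes of lists.

module _ {A : Set} (_≟_ : DecidableEquality A) where

  commonPrefix : List A → List A → ℕ
  commonPrefix [] _ = 0
  commonPrefix (_ ∷ _) [] = 0
  commonPrefix (x ∷ xs) (y ∷ ys) with x ≟ y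
  ... | yes _ = suc (commonPrefix xs ys)
  ... | no  _ = 0

  commonPrefix-sym : ∀ xs ys → commonPrefix xs ys ≡ commonPrefix ys xs
  commonPrefix-sym [] [] = refl
  commonPrefix-sym [] (_ ∷ _) = refl
  commonPrefix-sym (_ ∷ _) [] = refl
  commonPrefix-sym (x ∷ xs) (y ∷ ys) with x ≟ y | y ≟ x
  ... | yes _   | yes _   = cong suc (commonPrefix-sym xs ys)
  ... | no  _   | no  _   = refl
  ... | yes x≡y | no  y≢x = contradiction (sym x≡y) y≢x
  ... | no  x≢y | yes y≡x = contradiction (sym y≡x) x≢y

  commonPrefix-ultra : ∀ xs ys zs →
    commonPrefix xs ys ≤ commonPrefix xs zs ⊎ commonPrefix ys zs ≤ commonPrefix xs zs
  commonPrefix-ultra [] _ _ = inj₁ z≤n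
  commonPrefix-ultra (_ ∷ _) [] _ = inj₁ z≤n
  commonPrefix-ultra (_ ∷ _) (_ ∷ _) [] = inj₂ z≤n
  commonPrefix-ultra (x ∷ xs) (y ∷ ys) (z ∷ zs) with x ≟ y | y ≟ z | x ≟ z
  ... | no _     | _        | _       = inj₁ z≤n
  ... | yes _    | no _     | _       = inj₂ z≤n
  ... | yes refl | yes refl | yes _   = Sum.map s≤s s≤s (commonPrefix-ultra xs ys zs)
  ... | yes refl | yes refl | no x≢x  = contradiction refl x≢x

  commonPrefix-refl : ∀ xs → commonPrefix xs xs ≡ List.length xs
  commonPrefix-refl [] = refl
  commonPrefix-refl (x ∷ xs) with x ≟ x
  ... | yes _   = cong suc (commonPrefix-refl xs)
  ... | no  x≢x = contradiction refl x≢x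

  commonPrefix-le : ∀ xs ys → commonPrefix xs ys ≤ List.length xs
  commonPrefix-le [] _ = z≤n
  commonPrefix-le (_ ∷ _) [] = z≤n
  commonPrefix-le (x ∷ xs) (y ∷ ys) with x ≟ y
  ... | yes _ = s≤s (commonPrefix-le xs ys)
  ... | no  _ = z≤n

  commonPrefix-∷ʳ : ∀ xs a → commonPrefix (xs ∷ʳ a) xs ≡ List.length xs
  commonPrefix-∷ʳ [] a = refl
  commonPrefix-∷ʳ (x ∷ xs) a with x ≟ x
  ... | yes _   = cong suc (commonPrefix-∷ʳ xs a)
  ... | no  x≢x = contradiction refl x≢x

  commonPrefix-inj : ∀ xs ys →
    commonPrefix xs ys ≡ List.length xs → commonPrefix xs ys ≡ List.length ys → xs ≡ ys
  commonPrefix-inj [] [] _ _ = refl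
  commonPrefix-inj (x ∷ xs) (y ∷ ys) p q with x ≟ y
  ... | yes refl = cong (x ∷_) (commonPrefix-inj xs ys (suc-injective p) (suc-injective q))
  commonPrefix-inj (x ∷ xs) (y ∷ ys) () q | no _

-- The metric of a given tree.

module _ (T : Graph) where
  open Graph T

  private
    ∈-◅◅ : ∀ {u v w x} (p : Walk u v) (q : Walk v w) → x ∈ vertices (p ◅◅ q) →
      x ∈ vertices p ⊎ x ∈ vertices q
    ∈-◅◅ ε       q x∈ = inj₂ x∈
    ∈-◅◅ (_ ◅ p) q (here refl) = inj₁ (here refl)
    ∈-◅◅ (_ ◅ p) q (there x∈) = Sum.map₁ there (∈-◅◅ p q x∈)

    rev : ∀ {u v} → Walk u v → Walk v u
    rev ε       = ε
    rev (a ◅ p) = rev p ◅◅ (symm a ◅ ε)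

    ∈-rev : ∀ {u v x} (p : Walk u v) → x ∈ vertices (rev p) → x ∈ vertices p
    ∈-rev ε x∈ = x∈
    ∈-rev (a ◅ p) x∈ with ∈-◅◅ (rev p) (symm a ◅ ε) x∈
    ... | inj₁ x∈p                = there (∈-rev p x∈p)
    ... | inj₂ (here refl)         = there (source∈ T p)
    ... | inj₂ (there (here refl)) = here refl

  -- Two paths leaving u along different edges close up to a cycle through u.
  path-unique : Acyclic → ∀ {u v} (p q : Walk u v) → IsPath p → IsPath q → vertices p ≡ vertices q
  path-unique acyc ε ε _ _ = refl
  path-unique acyc ε (b ◅ q) _ path = contradiction refl (source-fresh T b q path (target∈ T q))
  path-unique acyc (a ◅ p) ε path _ = contradiction refl (source-fresh T a p path (target∈ T p))
  path-unique acyc {u} (_◅_ {j = x} a p) (_◅_ {j = y} b q) path@(_ AllPairs.∷ path₁) path′@(_ AllPairs.∷ path₂)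
    with x ≟ y
  ... | yes refl = cong (u ∷_) (path-unique acyc p q path₁ path₂)
  ... | no x≢y with r , rpath , r⊆ , _ ← toPath T (p ◅◅ rev q) =
    contradiction (symm b) (acyc (a ◅ r) (All.tabulate fresh AllPairs.∷ rpath) (s≤s (nonempty r)))
    where
    fresh : ∀ {w} → w ∈ vertices r → u ≢ w
    fresh w∈r = Sum.[ source-fresh T a p path , source-fresh T b q path′ ∘ ∈-rev q ]′ (∈-◅◅ p (rev q) (r⊆ w∈r))
    nonempty : (r : Walk x y) → 1 ≤ length r
    nonempty ε       = contradiction refl x≢y
    nonempty (_ ◅ _) = s≤s z≤n

  module _ (tree : IsTree) (root : V) where

    open DecMembership _≟_ using (_∈?_)

    private
      acyc = proj₂ tree

      π : ∀ x → Walk x root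
      π x = proj₁ (proj₂ (proj₁ tree) x root)

      π-path : ∀ x → IsPath (π x)
      π-path x = proj₂ (proj₂ (proj₁ tree) x root)

      P : V → List V
      P x = vertices (π x)

      P-unique : ∀ {x} (p : Walk x root) → IsPath p → vertices p ≡ P x
      P-unique {x} p path = path-unique acyc p (π x) path (π-path x)

      address : V → List V
      address x = reverse (P x)

    -- Addresses list the path from the root downwards, so a common prefix consists of the vertices
    -- that two such paths share. Counting vertices and not edges gives the root depth 1.
    treeMetric : V → V → ℕ
    treeMetric x y = commonPrefix _≟_ (address x) (address y)

    private
      level : ∀ x → treeMetric x x ≡ List.length (address x)
      level x = commonPrefix-refl _≟_ (address x)

      IsChild : V → V → Set
      IsChild x y = treeMetric x x ≡ suc (treeMetric y y) × treeMetric x y ≡ treeMetric y y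

      child : ∀ {x y} → P x ≡ x ∷ P y → IsChild x y
      child {x} {y} eq = length-eq , prefix-eq
        where
        open ≡-Reasoning
        addr : address x ≡ address y ∷ʳ x
        addr = trans (cong reverse eq) (unfold-reverse x (P y))
        length-eq : treeMetric x x ≡ suc (treeMetric y y)
        length-eq = begin
          treeMetric x x                  ≡⟨ level x ⟩
          List.length (address x)         ≡⟨ cong List.length addr ⟩
          List.length (address y ∷ʳ x)    ≡⟨ length-++ (address y) ⟩
          List.length (address y) + 1     ≡⟨ +-comm _ 1 ⟩
          suc (List.length (address y))   ≡⟨ cong suc (level y) ⟨
          suc (treeMetric y y)            ∎
        prefix-eq : treeMetric x y ≡ treeMetric y y
        prefix-eq = begin
          treeMetric x y                              ≡⟨ cong (λ l → commonPrefix _≟_ l (address y)) addr ⟩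
          commonPrefix _≟_ (address y ∷ʳ x) (address y) ≡⟨ commonPrefix-∷ʳ _≟_ (address y) x ⟩
          List.length (address y)                     ≡⟨ level y ⟨
          treeMetric y y                              ∎

      starts : ∀ {x y} (p : Walk x y) → ∃[ l ] vertices p ≡ x ∷ l
      starts ε       = _ , refl
      starts (_ ◅ _) = _ , refl

      head-eq : ∀ {x y u v} (p : Walk x u) (q : Walk y v) → vertices p ≡ vertices q → x ≡ y
      head-eq p q eq = ∷-injectiveˡ
        (trans (sym (proj₂ (starts p))) (trans eq (proj₂ (starts q))))

      ends : ∀ {x} (p : Walk x root) → ∃[ l ] reverse (vertices p) ≡ root ∷ l
      ends ε = [] , refl
      ends {x} (_ ◅ p) with l , eq ← ends p =
        l ∷ʳ x , trans (unfold-reverse x (vertices p)) (cong (_∷ʳ x) eq)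

      through-root : ∀ x → treeMetric root x ≡ treeMetric root root
      through-root x with l , eq ← ends (π x)
        rewrite sym (P-unique {root} ε (All.[] AllPairs.∷ AllPairs.[])) | eq with root ≟ root
      ... | yes _   = refl
      ... | no  r≢r = contradiction refl r≢r

      extend : ∀ {x y} → Adj x y → ¬ (x ∈ P y) → P x ≡ x ∷ P y
      extend {x} {y} x~y x∉ = sym (P-unique (x~y ◅ π y)
        (All.tabulate (λ w∈ x≡w → x∉ (subst (_∈ P y) (sym x≡w) w∈)) AllPairs.∷ π-path y))

      length-vertices : ∀ {x y} (p : Walk x y) → List.length (vertices p) ≡ suc (length p)
      length-vertices ε       = refl
      length-vertices (_ ◅ p) = cong suc (length-vertices p)

      shorter : ∀ {x y} → x ≢ y → x ∈ P y → List.length (P x) < List.length (P y)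
      shorter {x} {y} x≢y x∈ with q , path , _ , _ , lt ← pathFrom T (π y) (π-path y) x∈ =
        subst₂ _<_ (trans (sym (length-vertices q)) (cong List.length (P-unique q path)))
                   (sym (length-vertices (π y))) (s≤s (lt x≢y))

      -- If x is not on the path from y to the root, prefixing x to that path gives the path from x.
      -- Two distinct vertices cannot lie on each other's paths, as each path would be shorter than
      -- the other.
      dichotomy : ∀ {x y} → Adj x y → IsChild x y ⊎ IsChild y x
      dichotomy {x} {y} x~y with x ∈? P y | y ∈? P x
      ... | no x∉  | _      = inj₁ (child (extend x~y x∉))
      ... | yes _  | no y∉  = inj₂ (child (extend (symm x~y) y∉))
      ... | yes x∈ | yes y∈ = contradiction (shorter (x≢y ∘ sym) y∈) (<⇒≯ (shorter x≢y x∈))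
        where
        x≢y : x ≢ y
        x≢y refl = irrefl refl x~y

      climb : ∀ {x} (p : Walk x root) → IsPath p → x ≢ root → ∃[ y ] IsChild x y × Adj x y
      climb ε _ x≢r = contradiction refl x≢r
      climb {x} (_◅_ {j = y} a p) path@(_ AllPairs.∷ path′) x≢r =
        y , child (trans (sym (P-unique (a ◅ p) path)) (cong (x ∷_) (P-unique p path′))) , a

    isTreeMetric : IsTreeMetric T root treeMetric
    isTreeMetric = record
      { c-sym   = λ x y → commonPrefix-sym _≟_ (address x) (address y)
      ; c-ultra = λ x y z → commonPrefix-ultra _≟_ (address x) (address y) (address z)
      ; c-le    = λ x y → ≤-trans (commonPrefix-le _≟_ (address x) (address y)) (≤-reflexive (sym (level x)))
      ; c-inj   = λ {x} {y} p q → head-eq (π x) (π y) (reverse-injective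
                    (commonPrefix-inj _≟_ _ _ (trans p (level x)) (trans q (level y))))
      ; c-root  = through-root
      ; up      = λ x → climb (π x) (π-path x)
      ; split   = dichotomy
      }

-- From leaf powers to addressings.

module _ {k : ℕ} {G T : Graph} (tree : Graph.IsTree T) (iso : LeafPowerIso k G T) where
  private
    module G = Graph G
    module T = Graph T
  open LeafPowerIso iso

  private
    deeper : ∀ {root c} → IsTreeMetric T root c → ∀ {y} → T.Adj root y → c root root < c y y
    deeper {root} M {y} a with IsTreeMetric.split M a
    ... | inj₁ (ry , cry) = contradiction
            (trans (sym ry) (trans (sym (IsTreeMetric.c-root M y)) cry)) 1+n≢n
    ... | inj₂ (yr , _) = ≤-reflexive (sym yr)

  -- In the tree rooted at the leaf of u, a deepest vertex is childless and differs from the root,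
  -- which has a neighbour. So it is a second leaf.
  otherVertex : ∀ u → ∃[ v ] u ≢ v
  otherVertex u with optimumⱽ T {_≥_} (λ m n → ≤-total n m) (λ p q → ≤-trans q p)
                        {λ _ → ⊤} (λ _ → yes _) (λ x → treeMetric T tree (to u) x x)
  ... | inj₁ none = contradiction _ (none (to u))
  ... | inj₂ (x , _ , max) = v , λ u≡v → x≢root (trans (sym v↦x) (cong to (sym u≡v)))
    where
    M = isTreeMetric T tree (to u)
    x≢root : x ≢ to u
    x≢root refl with y , a , _ ← to-leaf u = <⇒≱ (deeper M a) (max y _)
    leaf : T.Leaf x
    leaf = IsTreeMetric.childless-leaf M x≢root
             (λ {z} (zx , _) → <⇒≱ (≤-reflexive (sym zx)) (max z _))
    v = proj₁ (onto-leaf leaf)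
    v↦x = proj₂ (onto-leaf leaf)

  private
    module _ {root c} (M : IsTreeMetric T root c) (inner : ∀ v → to v ≢ root) where
      open IsTreeMetric M hiding (adj⇔)

      pulled-back : IsAddressing k G (λ u v → c (to u) (to v))
      pulled-back = record
        { cp-sym   = λ u v → c-sym (to u) (to v)
        ; cp-ultra = λ u v w → c-ultra (to u) (to v) (to w)
        ; cp-sep   = λ {u} {v} u≢v → ≰⇒> λ below →
            let z , z↓u = childToward (to u) (to v) below (u≢v ∘ injective)
            in leaf-childless (inner u) (to-leaf u) z↓u
        ; cp-adj   = λ {u} {v} u≢v → mk⇔
            (λ u~v → path≤⇔ k (to u) (to v) .Equivalence.to (proj₂ (adj⇔ u v .Equivalence.to u~v)))
            (λ le → adj⇔ u v .Equivalence.from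
               (u≢v ∘ injective , path≤⇔ k (to u) (to v) .Equivalence.from le))
        }

    module _ (2≤k : 2 ≤ k) (complete : ∀ {u v} → u ≢ v → G.Adj u v) where

      -- These are the parting depths in a star rooted at its centre, whose leaves are at distance 2
      -- and hence at most k. The star replaces a tree that consists of a single edge, where every
      -- root is a leaf.
      δ : G.V → G.V → ℕ
      δ u v with u G.≟ v
      ... | yes _ = 1
      ... | no  _ = 0

      δ-refl : ∀ u → δ u u ≡ 1
      δ-refl u with u G.≟ u
      ... | yes _   = refl
      ... | no  u≢u = contradiction refl u≢u

      δ-≢ : ∀ {u v} → u ≢ v → δ u v ≡ 0
      δ-≢ {u} {v} u≢v with u G.≟ v
      ... | yes u≡v = contradiction u≡v u≢v
      ... | no  _   = refl

      discrete : IsAddressing k G δ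
      discrete = record
        { cp-sym   = δ-sym
        ; cp-ultra = δ-ultra
        ; cp-sep   = λ {u} u≢v → subst₂ _<_ (sym (δ-≢ u≢v)) (sym (δ-refl u)) (s≤s z≤n)
        ; cp-adj   = λ {u} {v} u≢v → mk⇔
            (λ _ → ≤-trans (≤-reflexive (cong₂ _+_ (δ-refl u) (δ-refl v))) (m≤n⇒m≤n+o _ 2≤k))
            (λ _ → complete u≢v)
        }
        where
        δ-sym : ∀ u v → δ u v ≡ δ v u
        δ-sym u v with u G.≟ v | v G.≟ u
        ... | yes _   | yes _   = refl
        ... | no  _   | no  _   = refl
        ... | yes u≡v | no  v≢u = contradiction (sym u≡v) v≢u
        ... | no  u≢v | yes v≡u = contradiction (sym v≡u) u≢v
        δ-ultra : ∀ u v w → δ u v ≤ δ u w ⊎ δ v w ≤ δ u w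
        δ-ultra u v w with u G.≟ v
        ... | yes refl = inj₂ ≤-refl
        ... | no _     = inj₁ z≤n

    -- A path from r must go to l first, and from l it could only return to r.
    two-leaves : ∀ {r l} → T.Leaf r → T.Leaf l → T.Adj r l → ∀ x → x ≡ r ⊎ x ≡ l
    two-leaves {r} {l} (_ , _ , r-unique) (_ , _ , l-unique) r~l x = go (proj₂ (proj₂ (proj₁ tree) r x))
      where
      go : {p : T.Walk r x} → T.IsPath p → x ≡ r ⊎ x ≡ l
      go {ε} _ = inj₁ refl
      go {a ◅ ε} _ = inj₂ (trans (sym (r-unique a)) (r-unique r~l))
      go {a ◅ b ◅ p} path with refl ← trans (sym (r-unique a)) (r-unique r~l) =
        contradiction (trans (sym (l-unique (T.symm r~l))) (l-unique b))
                      (source-fresh T a (b ◅ p) path (there (source∈ T p)))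

  -- A root that is a leaf would be an ancestor of all other leaves and violate `cp-sep`. So the
  -- root is the neighbour of some leaf; if this is a leaf as well, the tree is a single edge and G
  -- is complete.
  leafPower⇒addressing : 2 ≤ k → ∃ (IsAddressing k G)
  leafPower⇒addressing 2≤k with anyⱽ? G {λ _ → ⊤} (λ _ → yes _)
  ... | no none = (λ _ _ → 0) , record
        { cp-sym = λ _ _ → refl ; cp-ultra = λ _ _ _ → inj₁ z≤n
        ; cp-sep = λ {u} → contradiction (u , _) none
        ; cp-adj = λ {u} → contradiction (u , _) none }
  ... | yes (v₀ , _) with root , v₀~root , _ ← to-leaf v₀ with anyⱽ? G (λ v → to v T.≟ root)
  ...   | no inner = _ , pulled-back (isTreeMetric T tree root) (λ v eq → inner (v , eq))
  ...   | yes (v₁ , refl) = _ , discrete 2≤k complete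
    where
    adjacent : ∀ {x y} → x ≢ y → T.Adj x y
    adjacent {x} {y} x≢y with two-leaves (to-leaf v₁) (to-leaf v₀) (T.symm v₀~root) x
                            | two-leaves (to-leaf v₁) (to-leaf v₀) (T.symm v₀~root) y
    ... | inj₁ refl | inj₁ refl = contradiction refl x≢y
    ... | inj₁ refl | inj₂ refl = T.symm v₀~root
    ... | inj₂ refl | inj₁ refl = v₀~root
    ... | inj₂ refl | inj₂ refl = contradiction refl x≢y
    complete : ∀ {u v} → u ≢ v → G.Adj u v
    complete {u} {v} u≢v = adj⇔ u v .Equivalence.from
      ( u≢v ∘ injective , (adjacent (u≢v ∘ injective) ◅ ε)
      , ((u≢v ∘ injective) All.∷ All.[]) AllPairs.∷ (All.[] AllPairs.∷ AllPairs.[])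
      , ≤-trans (s≤s z≤n) 2≤k)

-- From addressings to trees.

-- This stands in for a quotient: positions in the list of representatives are a finite type in
-- which related elements have become equal.
representatives : {A : Set} {P : Pred A 0ℓ} {R : Rel A 0ℓ} → (∀ x y → Dec (R x y)) → (∀ {x} → P x → R x x) →
  ∀ {xs} → All P xs → ∃[ ys ] All P ys × AllPairs (λ x y → ¬ R x y) ys × (∀ {x} → x ∈ xs → Any (R x) ys)
representatives R? R-refl All.[] = [] , All.[] , AllPairs.[] , λ ()
representatives R? R-refl {x ∷ xs} (px All.∷ pxs) with ys , pys , sep , cover ← representatives R? R-refl pxs
  with Any.any? (R? x) ys
... | yes found = ys , pys , sep , λ { (here refl) → found ; (there x∈xs) → cover x∈xs }
... | no none = x ∷ ys , px All.∷ pys , All.tabulate (λ y∈ys r → none (lose y∈ys r)) AllPairs.∷ sep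
              , λ { (here refl) → here (R-refl px) ; (there x∈xs) → there (cover x∈xs) }

separated⇒injective : {A : Set} {R : Rel A 0ℓ} → (∀ {x y} → R x y → R y x) →
  ∀ {xs} → AllPairs (λ x y → ¬ R x y) xs → ∀ i j → R (lookup xs i) (lookup xs j) → i ≡ j
separated⇒injective R-sym (sep AllPairs.∷ seps) zero    zero    r = refl
separated⇒injective R-sym (sep AllPairs.∷ seps) zero    (suc j) r = contradiction r (All.lookup sep (∈-lookup j))
separated⇒injective R-sym (sep AllPairs.∷ seps) (suc i) zero    r = contradiction (R-sym r) (All.lookup sep (∈-lookup i))
separated⇒injective R-sym (sep AllPairs.∷ seps) (suc i) (suc j) r = cong suc (separated⇒injective R-sym seps i j r)

-- The vertices of the tree are the pairs (v , j) with m ≤ j ≤ cp v v, standing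
-- for the ancestor of v at depth j, where (v , j) and (w , j) are identified
-- when j ≤ cp v w. Depths start from m, where all paths from the root to a leaf
-- have parted, in order that the root not become a leaf.
module _ {k : ℕ} {G : Graph} {cp : Graph.V G → Graph.V G → ℕ} (A : IsAddressing k G cp)
         (other : (u : Graph.V G) → ∃[ v ] u ≢ v)
         (u₀ w₀ : Graph.V G) (least : (w : Graph.V G) → cp u₀ w₀ ≤ cp u₀ w) where
  private
    module G = Graph G
    open IsAddressing A

    m = cp u₀ w₀

    cp-chain : ∀ {n} u v w → n ≤ cp u v → n ≤ cp v w → n ≤ cp u w
    cp-chain u v w uv vw = Sum.[ ≤-trans uv , ≤-trans vw ]′ (cp-ultra u v w)

    cp-flip : ∀ {n} u v → n ≤ cp u v → n ≤ cp v u
    cp-flip u v le = ≤-trans le (≤-reflexive (cp-sym u v))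

    -- By the ultrametric inequality through `u₀`, the least value in the row of `u₀` is the least
    -- value overall.
    m≤cp : ∀ u v → m ≤ cp u v
    m≤cp u v = cp-chain u u₀ v (cp-flip u₀ u (least u)) (least v)

    m<cp : ∀ u → m < cp u u
    m<cp u with v , u≢v ← other u = ≤-<-trans (m≤cp u v) (cp-sep u≢v)

    Pair : Set
    Pair = G.V × ℕ

    Valid : Pair → Set
    Valid (v , j) = m ≤ j × j ≤ cp v v

    _≈_ : Pair → Pair → Set
    (v , i) ≈ (w , j) = i ≡ j × i ≤ cp v w

    _≈?_ : ∀ x y → Dec (x ≈ y)
    (v , i) ≈? (w , j) = (i ℕ.≟ j) ×-dec (i ≤? cp v w)

    ≈-sym : ∀ {x y} → x ≈ y → y ≈ x
    ≈-sym {v , _} {w , _} (refl , le) = refl , cp-flip v w le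

    pairs : List Pair
    pairs = concatMap (λ v → map (v ,_) (filter (m ≤?_) (upTo (suc (cp v v))))) (enumeration G)

    pairs-valid : All Valid pairs
    pairs-valid = All.tabulate valid
      where
      valid : ∀ {x} → x ∈ pairs → Valid x
      valid x∈ with v , _ , x∈′ ← find (∈-concatMap⁻ _ {xs = enumeration G} x∈)
        with j , j∈ , refl ← ∈-map⁻ (v ,_) x∈′
        with j∈upTo , m≤j ← ∈-filter⁻ (m ≤?_) {xs = upTo (suc (cp v v))} j∈ = m≤j , ≤-pred (∈-upTo⁻ j∈upTo)

    pairs-complete : ∀ {x} → Valid x → x ∈ pairs
    pairs-complete {v , j} (m≤j , j≤) = ∈-concatMap⁺ _ (lose (enumerated G v)
      (∈-map⁺ (v ,_) (∈-filter⁺ (m ≤?_) (∈-upTo⁺ (s≤s j≤)) m≤j)))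

    abstract
      reps : ∃[ ys ] All Valid ys × AllPairs (λ x y → ¬ x ≈ y) ys × (∀ {x} → Valid x → Any (x ≈_) ys)
      reps with ys , valid , sep , cover ← representatives _≈?_ (λ (_ , le) → refl , le) pairs-valid =
        ys , valid , sep , cover ∘ pairs-complete

    nodes = proj₁ reps

    Node : Set
    Node = Fin (List.length nodes)

    at : Node → G.V
    at x = proj₁ (lookup nodes x)

    depth : Node → ℕ
    depth x = proj₂ (lookup nodes x)

    depth≥ : ∀ x → m ≤ depth x
    depth≥ x = proj₁ (All.lookup (proj₁ (proj₂ reps)) (∈-lookup x))

    depth≤ : ∀ x → depth x ≤ cp (at x) (at x)
    depth≤ x = proj₂ (All.lookup (proj₁ (proj₂ reps)) (∈-lookup x))

    same : ∀ {x y} → depth x ≡ depth y → depth x ≤ cp (at x) (at y) → x ≡ y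
    same {x} {y} eq le = separated⇒injective ≈-sym (proj₁ (proj₂ (proj₂ reps))) x y (eq , le)

    abstract
     node : ∀ v j → m ≤ j → j ≤ cp v v → ∃[ x ] depth x ≡ j × j ≤ cp v (at x)
     node v j m≤j j≤ = let r = proj₂ (proj₂ (proj₂ reps)) {v , j} (m≤j , j≤) in
       index r , sym (proj₁ (lookup-index r)) , proj₂ (lookup-index r)

    -- The paths to two ancestors part where those to the chosen leaves below them do, unless one of
    -- them ends before.
    c : Node → Node → ℕ
    c x y = depth x ⊓ depth y ⊓ cp (at x) (at y)

    c-diag : ∀ x → c x x ≡ depth x
    c-diag x = trans (cong (_⊓ cp (at x) (at x)) (⊓-idem (depth x))) (m≤n⇒m⊓n≡m (depth≤ x))

    c≤₁ : ∀ x y → c x y ≤ depth x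
    c≤₁ x y = ≤-trans (m⊓n≤m _ _) (m⊓n≤m _ _)

    c≤₂ : ∀ x y → c x y ≤ depth y
    c≤₂ x y = ≤-trans (m⊓n≤m _ _) (m⊓n≤n (depth x) _)

    c≤₃ : ∀ x y → c x y ≤ cp (at x) (at y)
    c≤₃ x y = m⊓n≤n (depth x ⊓ depth y) _

    c≥ : ∀ {n} x y → n ≤ depth x → n ≤ depth y → n ≤ cp (at x) (at y) → n ≤ c x y
    c≥ x y p q r = ⊓-glb (⊓-glb p q) r

    Child : Node → Node → Set
    Child x y = c x x ≡ suc (c y y) × c x y ≡ c y y

    child : ∀ {x y} → depth x ≡ suc (depth y) → depth y ≤ cp (at x) (at y) → Child x y
    child {x} {y} eq le =
        trans (c-diag x) (trans eq (cong suc (sym (c-diag y))))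
      , trans (≤-antisym (c≤₂ x y) (c≥ x y (≤-trans (n≤1+n _) (≤-reflexive (sym eq))) ≤-refl le)) (sym (c-diag y))

    child? : ∀ x y → Dec (Child x y)
    child? x y = (c x x ℕ.≟ suc (c y y)) ×-dec (c x y ℕ.≟ c y y)

  rootedTree : Graph
  rootedTree = record
    { V      = Node
    ; order  = List.length nodes
    ; finite = ↔-id Node
    ; Adj    = λ x y → Child x y ⊎ Child y x
    ; adj?   = λ x y → child? x y ⊎-dec child? y x
    ; symm   = Sum.swap
    ; irrefl = λ { refl → Sum.[ 1+n≢n ∘ sym ∘ proj₁ , 1+n≢n ∘ sym ∘ proj₁ ]′ }
    }

  private
    root-node = node u₀ m ≤-refl (<⇒≤ (m<cp u₀))
    root = proj₁ root-node
    root-depth : depth root ≡ m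
    root-depth = proj₁ (proj₂ root-node)

    isRoot : ∀ {x} → depth x ≡ m → x ≡ root
    isRoot {x} eq = same (trans eq (sym root-depth)) (≤-trans (≤-reflexive eq) (m≤cp _ _))

    metric : IsTreeMetric rootedTree root c
    metric = record
      { c-sym   = λ x y → cong₂ _⊓_ (⊓-comm (depth x) (depth y)) (cp-sym (at x) (at y))
      ; c-ultra = ultra
      ; c-le    = λ x y → ≤-trans (c≤₁ x y) (≤-reflexive (sym (c-diag x)))
      ; c-inj   = λ {x} {y} p q → same (trans (sym (c-diag x)) (trans (sym p) (trans q (c-diag y))))
                    (≤-trans (≤-reflexive (trans (sym (c-diag x)) (sym p))) (c≤₃ x y))
      ; c-root  = λ x → ≤-antisym
          (≤-trans (c≤₁ root x) (≤-reflexive (sym (c-diag root))))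
          (≤-trans (≤-reflexive (trans (c-diag root) root-depth))
             (c≥ root x (depth≥ root) (depth≥ x) (m≤cp _ _)))
      ; up      = up
      ; split   = id
      }
      where
      ultra : ∀ x y z → c x y ≤ c x z ⊎ c y z ≤ c x z
      ultra x y z with ⊓-sel (depth x ⊓ depth z) (cp (at x) (at z)) | ⊓-sel (depth x) (depth z)
      ... | inj₁ eq | inj₁ eq′ = inj₁ (≤-trans (c≤₁ x y) (≤-reflexive (sym (trans eq eq′))))
      ... | inj₁ eq | inj₂ eq′ = inj₂ (≤-trans (c≤₂ y z) (≤-reflexive (sym (trans eq eq′))))
      ... | inj₂ eq | _ = Sum.map
              (λ le → ≤-trans (c≤₃ x y) (≤-trans le (≤-reflexive (sym eq))))
              (λ le → ≤-trans (c≤₃ y z) (≤-trans le (≤-reflexive (sym eq))))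
              (cp-ultra (at x) (at y) (at z))

      up : ∀ x → x ≢ root → ∃[ y ] Child x y × (Child x y ⊎ Child y x)
      up x x≢r = go (depth x) refl
        where
        go : ∀ d → depth x ≡ d → ∃[ y ] Child x y × (Child x y ⊎ Child y x)
        go zero eq = contradiction (isRoot (trans eq (sym (n≤0⇒n≡0 (≤-trans (depth≥ x) (≤-reflexive eq)))))) x≢r
        go (suc j) eq = y , x↓y , inj₁ x↓y
          where
          m≤j : m ≤ j
          m≤j = ≤-pred (≤-trans (≤∧≢⇒< (depth≥ x) (λ m≡ → x≢r (isRoot (sym m≡)))) (≤-reflexive eq))
          below = node (at x) j m≤j (≤-trans (n≤1+n j) (≤-trans (≤-reflexive (sym eq)) (depth≤ x)))
          y = proj₁ below
          x↓y : Child x y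
          x↓y = child (trans eq (cong suc (sym (proj₁ (proj₂ below)))))
                      (≤-trans (≤-reflexive (proj₁ (proj₂ below))) (proj₂ (proj₂ below)))

    open IsTreeMetric metric using (isTree; path≤⇔; leaf-childless; childless-leaf)
    module T = Graph rootedTree

    childOf : ∀ x w → suc (depth x) ≤ cp w w → depth x ≤ cp w (at x) →
      ∃[ z ] Child z x × suc (depth x) ≤ cp w (at z)
    childOf x w le le′ with z , dz , le″ ← node w (suc (depth x)) (m≤n⇒m≤1+n (depth≥ x)) le =
      z , child dz (cp-chain (at z) w (at x) (cp-flip w (at z) (≤-trans (n≤1+n _) le″)) le′) , le″

    leaf : G.V → Node
    leaf u = proj₁ (node u (cp u u) (<⇒≤ (m<cp u)) ≤-refl)

    leaf-depth : ∀ u → depth (leaf u) ≡ cp u u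
    leaf-depth u = proj₁ (proj₂ (node u (cp u u) (<⇒≤ (m<cp u)) ≤-refl))

    -- The pair of u and its full depth is identified with no pair of another vertex v, as `cp u v`
    -- is less than `cp u u`.
    leaf-at : ∀ u → at (leaf u) ≡ u
    leaf-at u with u G.≟ at (leaf u)
    ... | yes eq = sym eq
    ... | no u≢ = contradiction (cp-sep u≢) (≤⇒≯ (proj₂ (proj₂ (node u (cp u u) (<⇒≤ (m<cp u)) ≤-refl))))

    leaf-leaf : ∀ u → T.Leaf (leaf u)
    leaf-leaf u = childless-leaf
      (λ eq → <⇒≢ (m<cp u) (trans (sym root-depth) (trans (cong depth (sym eq)) (leaf-depth u))))
      λ {z} z↓ → none z z↓
      where
      none : ∀ z → ¬ Child z (leaf u)
      none z (eq , eq′) with u G.≟ at z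
      ... | yes u≡ = 1+n≰n (≤-trans (≤-reflexive (sym d))
              (≤-trans (depth≤ z) (≤-reflexive (sym (cong₂ cp u≡ u≡)))))
        where
        d : depth z ≡ suc (cp u u)
        d = trans (sym (c-diag z)) (trans eq (cong suc (trans (c-diag (leaf u)) (leaf-depth u))))
      ... | no u≢ = <⇒≱ (cp-sep u≢) (≤-trans
              (≤-reflexive (sym (trans eq′ (trans (c-diag (leaf u)) (leaf-depth u)))))
              (≤-trans (c≤₃ z (leaf u)) (cp-flip _ _ (≤-reflexive (cong (cp (at z)) (leaf-at u))))))

    leaf-onto : ∀ {x} → T.Leaf x → ∃[ u ] leaf u ≡ x
    leaf-onto {x} isLeaf@(_ , _ , unique) with cp (at x) (at x) ≤? depth x
    ... | yes full = at x , same (trans (leaf-depth (at x)) (≤-antisym full (depth≤ x)))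
            (≤-reflexive (trans (leaf-depth (at x)) (cong (λ v → cp v (at x)) (sym (leaf-at (at x))))))
    ... | no ¬full with x ≟ᶠ root
    ...   | no x≢r = contradiction (proj₁ (proj₂ (childOf x (at x) (≰⇒> ¬full) (depth≤ x)))) (leaf-childless x≢r isLeaf)
    -- The root is not a leaf: it has a child on the way to `u₀` and one on the way to `w₀`, and
    -- these differ because `u₀` and `w₀` part at depth m, the depth of the root.
    ...   | yes refl
      with a , a↓ , le ← childOf root u₀
             (≤-trans (≤-reflexive (cong suc root-depth)) (m<cp u₀)) (≤-trans (≤-reflexive root-depth) (m≤cp _ _))
         | b , b↓ , le′ ← childOf root w₀
             (≤-trans (≤-reflexive (cong suc root-depth)) (m<cp w₀)) (≤-trans (≤-reflexive root-depth) (m≤cp _ _))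
      with refl ← trans (sym (unique (inj₂ a↓))) (unique (inj₂ b↓)) =
        contradiction
          (≤-trans (≤-reflexive (cong suc (sym root-depth)))
            (cp-chain u₀ (at a) w₀ le (cp-flip w₀ (at a) le′)))
          1+n≰n

    leaf-injective : ∀ {u v} → leaf u ≡ leaf v → u ≡ v
    leaf-injective {u} {v} eq = trans (sym (leaf-at u)) (trans (cong at eq) (leaf-at v))

    c-leaf : ∀ u v → c (leaf u) (leaf v) ≡ cp u v
    c-leaf u v = trans (cong₂ _⊓_ (cong₂ _⊓_ (leaf-depth u) (leaf-depth v)) (cong₂ cp (leaf-at u) (leaf-at v)))
                       (m≥n⇒m⊓n≡n (⊓-glb (cp≤ u v) (≤-trans (≤-reflexive (cp-sym u v)) (cp≤ v u))))
      where
      cp≤ : ∀ u v → cp u v ≤ cp u u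
      cp≤ u v with u G.≟ v
      ... | yes refl = ≤-refl
      ... | no u≢v   = <⇒≤ (cp-sep u≢v)

    close⇔ : ∀ u v →
      (∃[ p ] T.IsPath {leaf u} {leaf v} p × T.length p ≤ k) ⇔ cp u u + cp v v ≤ k + (cp u v + cp u v)
    close⇔ u v = subst₂ (λ d e → (∃[ p ] T.IsPath {leaf u} {leaf v} p × T.length p ≤ k) ⇔ d ≤ k + e)
      (cong₂ _+_ (c-leaf u u) (c-leaf v v)) (cong₂ _+_ (c-leaf u v) (c-leaf u v)) (path≤⇔ k (leaf u) (leaf v))

  nonempty-leafPower : IsLeafPower k G
  nonempty-leafPower = rootedTree , isTree , record
    { to        = leaf
    ; injective = leaf-injective
    ; to-leaf   = leaf-leaf
    ; onto-leaf = leaf-onto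
    ; adj⇔      = λ u v → mk⇔
        (λ u~v → let u≢v = λ u≡v → G.irrefl u≡v u~v in
          u≢v ∘ leaf-injective , close⇔ u v .Equivalence.from (cp-adj u≢v .Equivalence.to u~v))
        (λ (ne , p) → cp-adj (ne ∘ cong leaf) .Equivalence.from (close⇔ u v .Equivalence.to p))
    }

addressing⇒leafPower : ∀ {k G cp} → IsAddressing k G cp → (∀ u → ∃[ v ] u ≢ v) → IsLeafPower k G
addressing⇒leafPower {k} {G} {cp} A other with anyⱽ? G {λ _ → ⊤} (λ _ → yes _)
... | yes (u₀ , _) with optimumⱽ G ≤-total ≤-trans {λ _ → ⊤} (λ _ → yes _) (cp u₀)
...   | inj₁ none = contradiction _ (none u₀)
...   | inj₂ (w₀ , _ , least) = nonempty-leafPower A other u₀ w₀ (λ w → least w _)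
-- A graph without vertices is the leaf power of the one-vertex tree, which has no leaves.
addressing⇒leafPower {k} {G} {cp} A other | no none = point , (connected , λ { p _ _ () }) , record
  { to        = λ u → contradiction (u , _) none
  ; injective = λ {u} → contradiction (u , _) none
  ; to-leaf   = λ u → contradiction (u , _) none
  ; onto-leaf = λ { (_ , () , _) }
  ; adj⇔      = λ u → contradiction (u , _) none
  }
  where
  point : Graph
  point = record
    { V = Fin 1 ; order = 1 ; finite = ↔-id (Fin 1) ; Adj = λ _ _ → ⊥
    ; adj? = λ _ _ → no λ () ; symm = λ () ; irrefl = λ _ () }
  connected : Graph.Connected point
  connected = zero , λ { zero zero → ε , All.[] AllPairs.∷ AllPairs.[] }

-- Formulas and their meaning in the product.

∀-⇔ : {A : Set} {B C : A → Set} → (∀ x → B x ⇔ C x) → (∀ x → B x) ⇔ (∀ x → C x)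
∀-⇔ eq = mk⇔ (λ f x → eq x .Equivalence.to (f x)) (λ f x → eq x .Equivalence.from (f x))

∃-⇔ : {A : Set} {B C : A → Set} → (∀ x → B x ⇔ C x) → ∃ B ⇔ ∃ C
∃-⇔ eq = mk⇔ (λ (x , b) → x , eq x .Equivalence.to b) (λ (x , c) → x , eq x .Equivalence.from c)

infixr 4 _⇒-⇔_
_⇒-⇔_ : {A B C D : Set} → A ⇔ B → C ⇔ D → (A → C) ⇔ (B → D)
_⇒-⇔_ = →-cong-⇔

⌊⌋-cong : {A B : Set} {a? : Dec A} {b? : Dec B} → (A → B) → (B → A) → ⌊ a? ⌋ ≡ ⌊ b? ⌋
⌊⌋-cong {a? = yes _} {yes _} _ _ = refl
⌊⌋-cong {a? = no _}  {no _}  _ _ = refl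
⌊⌋-cong {a? = yes a} {no ¬b} f _ = contradiction (f a) ¬b
⌊⌋-cong {a? = no ¬a} {yes b} _ g = contradiction (g b) ¬a

pattern v₀ = here refl
pattern v₁ = there v₀
pattern v₂ = there v₁
pattern 3+ x = there (there (there x))

module _ {Γ : Context} where

  opaque
    -- Arithmetic enters formulas only in this way: a conjunction runs over all values of the labels
    -- involved, and for fixed values a condition on them is constantly true or false.
    ⌈_⌉ : {A : Set} → Dec A → Formula Γ
    ⌈ yes _ ⌉ = ⊥′ ⇒ ⊥′
    ⌈ no  _ ⌉ = ⊥′

    ⋀ ⋁ : ∀ n → (Fin n → Formula Γ) → Formula Γ
    ⋀ zero    φ = ⊥′ ⇒ ⊥′
    ⋀ (suc n) φ = φ zero ∧ ⋀ n (φ ∘ suc)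
    ⋁ zero    φ = ⊥′
    ⋁ (suc n) φ = φ zero ∨ ⋁ n (φ ∘ suc)

    -- The copies of one vertex of G form a component of the graph of horizontal edges, and x and y
    -- share a component when every set closed under these edges that contains x contains y.
    sameᶠ : edgeSet ∈ Γ → vertex ∈ Γ → vertex ∈ Γ → Formula Γ
    sameᶠ h x y = all′ vertexSet
      (all′ edge (all′ vertex (all′ vertex
        (v₂ ∈ᴱ there (3+ h) ∧ inc v₂ v₁ ∧ inc v₂ v₀ ∧ v₁ ∈ⱽ 3+ v₀ ⇒ v₀ ∈ⱽ 3+ v₀)))
       ⇒ there x ∈ⱽ v₀ ⇒ there y ∈ⱽ v₀)

¬ᶠ_ : ∀ {Γ} → Formula Γ → Formula Γ
¬ᶠ φ = φ ⇒ ⊥′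

module _ {Γ : Context} where

  opaque
    adjᶠ : edgeSet ∈ Γ → vertex ∈ Γ → vertex ∈ Γ → Formula Γ
    adjᶠ h x y = ¬ᶠ sameᶠ h x y ∧
      ex′ edge (ex′ vertex (ex′ vertex
        (inc v₂ v₁ ∧ inc v₂ v₀ ∧ sameᶠ (3+ h) (3+ x) v₁ ∧ sameᶠ (3+ h) (3+ y) v₀)))

    -- Rotating the cycle preserves the product and its horizontal edges, so no formula singles out
    -- a layer. Therefore the sets `S₀` and `S₁`, meant as two adjacent layers, are variables that
    -- get quantified along with the edge sets.
    labᶠ : (h : edgeSet ∈ Γ) (S₀ S₁ : vertexSet ∈ Γ) (E : edgeSet ∈ Γ) → vertex ∈ Γ → vertex ∈ Γ → Formula Γ
    labᶠ h S₀ S₁ E x y = ex′ edge (ex′ vertex (ex′ vertex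
      (v₂ ∈ᴱ 3+ E ∧ v₁ ∈ⱽ 3+ S₀ ∧ v₀ ∈ⱽ 3+ S₁ ∧ inc v₂ v₁ ∧ inc v₂ v₀ ∧
       sameᶠ (3+ h) (3+ x) v₁ ∧ sameᶠ (3+ h) (3+ y) v₀)))

module _ (k′ : ℕ) (G : Graph) where
  private
    k : ℕ
    k = suc (suc k′)
    P : Graph
    P = G ⊠ cycle k
    module G = Graph G
    module P = Graph P
  open Semantics P

  module _ {Γ} {ρ : Env Γ} where

    opaque
      unfolding ⌈_⌉ ⋀ ⋁

      ⌈⌉⇔ : {A : Set} (a? : Dec A) → Sat ρ ⌈ a? ⌉ ⇔ A
      ⌈⌉⇔ (yes a) = mk⇔ (λ _ → a) (λ _ → id)
      ⌈⌉⇔ (no ¬a) = mk⇔ (λ ()) ¬a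

      ⋀⇔ : ∀ {n} {φ : Fin n → Formula Γ} {A : Fin n → Set} →
        (∀ i → Sat ρ (φ i) ⇔ A i) → Sat ρ (⋀ n φ) ⇔ (∀ i → A i)
      ⋀⇔ {zero}  eq = mk⇔ (λ _ ()) (λ _ → id)
      ⋀⇔ {suc n} eq = mk⇔
        (λ { (a , as) zero → eq zero .Equivalence.to a
           ; (a , as) (suc i) → ⋀⇔ (eq ∘ suc) .Equivalence.to as i })
        (λ f → eq zero .Equivalence.from (f zero) , ⋀⇔ (eq ∘ suc) .Equivalence.from (f ∘ suc))

      ⋁⇔ : ∀ {n} {φ : Fin n → Formula Γ} {A : Fin n → Set} →
        (∀ i → Sat ρ (φ i) ⇔ A i) → Sat ρ (⋁ n φ) ⇔ ∃ A
      ⋁⇔ {zero}  eq = mk⇔ (λ ()) (λ ())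
      ⋁⇔ {suc n} eq = mk⇔
        (λ { (inj₁ a) → zero , eq zero .Equivalence.to a
           ; (inj₂ as) → let i , a = ⋁⇔ (eq ∘ suc) .Equivalence.to as in suc i , a })
        (λ { (zero , a) → inj₁ (eq zero .Equivalence.from a)
           ; (suc i , a) → inj₂ (⋁⇔ (eq ∘ suc) .Equivalence.from (i , a)) })

  opaque
    unfolding sameᶠ

    same⇔ : ∀ {Γ} (ρ : Env Γ) (h : edgeSet ∈ Γ) → All.lookup ρ h ≡ horizontal G (cycle k) →
      (x y : vertex ∈ Γ) → Sat ρ (sameᶠ h x y) ⇔ (proj₁ (All.lookup ρ x) ≡ proj₁ (All.lookup ρ y))
    same⇔ ρ h hor x y = mk⇔ to from
      where
      Closed : (P.V → Bool) → Set
      Closed X = ∀ e s t →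
        T (P.member (All.lookup ρ h) e) × P.Incident e s × P.Incident e t × T (X s) → T (X t)

      to : (∀ X → Closed X → T (X (All.lookup ρ x)) → T (X (All.lookup ρ y))) →
        proj₁ (All.lookup ρ x) ≡ proj₁ (All.lookup ρ y)
      to sat = toWitness (sat (λ z → ⌊ proj₁ (All.lookup ρ x) G.≟ proj₁ z ⌋) closed (fromWitness refl))
        where
        closed : Closed (λ z → ⌊ proj₁ (All.lookup ρ x) G.≟ proj₁ z ⌋)
        closed e s t (e∈ , incs , inct , Xs) = fromWitness (trans (toWitness Xs) (ends incs inct))
          where
          level : proj₁ (P.src e) ≡ proj₁ (P.tgt e)
          level = toWitness (subst (λ H → T (P.member H e)) hor e∈)
          ends : P.Incident e s → P.Incident e t → proj₁ s ≡ proj₁ t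
          ends (inj₁ refl) (inj₁ refl) = refl
          ends (inj₁ refl) (inj₂ refl) = level
          ends (inj₂ refl) (inj₁ refl) = sym level
          ends (inj₂ refl) (inj₂ refl) = refl

      from : proj₁ (All.lookup ρ x) ≡ proj₁ (All.lookup ρ y) →
        ∀ X → Closed X → T (X (All.lookup ρ x)) → T (X (All.lookup ρ y))
      from eq X closed with All.lookup ρ x | All.lookup ρ y
      -- The copies of u in the layers from 0 on form a path of horizontal edges, along which
      -- membership in X spreads both ways.
      from refl X closed | u , i | .u , j = proj₁ (fibre j) ∘ proj₂ (fibre i)
        where
        step : ∀ (i : Fin (suc k′)) → P.Adj (u , inject₁ i) (u , suc i)
        step i = (λ eq → i≢ (cong proj₂ eq)) , inj₁ refl , inj₂ (i≢ , inj₁ (inj₁ (cong suc (sym (toℕ-inject₁ i)))))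
          where
          i≢ : inject₁ i ≢ suc i
          i≢ eq = 1+n≢n (trans (cong toℕ (sym eq)) (toℕ-inject₁ i))
        e∈H : ∀ i → T (P.member (All.lookup ρ h) (P.edge _ _ (step i)))
        e∈H i = subst (λ H → T (P.member H (P.edge _ _ (step i)))) (sym hor) (fromWitness refl)
        fibre : ∀ i → (T (X (u , zero)) → T (X (u , i))) × (T (X (u , i)) → T (X (u , zero)))
        fibre = <-weakInduction _ (id , id) λ i (f , g) →
            (λ a → closed (P.edge _ _ (step i)) _ _ (e∈H i , inj₁ refl , inj₂ refl , f a))
          , (λ a → g (closed (P.edge _ _ (step i)) _ _ (e∈H i , inj₂ refl , inj₁ refl , a)))

  private
    bind : ∀ {Γ} → Env Γ → P.Edge → P.V → P.V → Env (vertex ∷ vertex ∷ edge ∷ Γ)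
    bind ρ e s t = All._∷_ {x = vertex} t (All._∷_ {x = vertex} s (All._∷_ {x = edge} e ρ))

  opaque
    unfolding adjᶠ

    adjᶠ⇔ : ∀ {Γ} (ρ : Env Γ) (h : edgeSet ∈ Γ) → All.lookup ρ h ≡ horizontal G (cycle k) →
      (x y : vertex ∈ Γ) → Sat ρ (adjᶠ h x y) ⇔ G.Adj (proj₁ (All.lookup ρ x)) (proj₁ (All.lookup ρ y))
    adjᶠ⇔ ρ h hor x y = ⇔-trans
      ((same⇔ ρ h hor x y ⇒-⇔ ⇔-refl) ×-⇔ ∃-⇔ λ e → ∃-⇔ λ s → ∃-⇔ λ t → ⇔-refl ×-⇔ ⇔-refl ×-⇔
        same⇔ (bind ρ e s t) (3+ h) hor (3+ x) v₁ ×-⇔ same⇔ (bind ρ e s t) (3+ h) hor (3+ y) v₀)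
      (core _ _)
      where
      Joined : G.V → G.V → Set
      Joined u v = u ≢ v × ∃[ e ] ∃[ s ] ∃[ t ] P.Incident e s × P.Incident e t × u ≡ proj₁ s × v ≡ proj₁ t

      core : ∀ u v → Joined u v ⇔ G.Adj u v
      core u v = mk⇔ to from
        where
        to : Joined u v → G.Adj u v
        to (u≢v , P.edge _ _ _ , _ , _ , inj₁ refl , inj₁ refl , refl , refl) = contradiction refl u≢v
        to (u≢v , P.edge _ _ _ , _ , _ , inj₂ refl , inj₂ refl , refl , refl) = contradiction refl u≢v
        to (u≢v , P.edge _ _ (_ , a , _) , _ , _ , inj₁ refl , inj₂ refl , refl , refl) =
          Sum.[ (λ eq → contradiction eq u≢v) , id ]′ a
        to (u≢v , P.edge _ _ (_ , a , _) , _ , _ , inj₂ refl , inj₁ refl , refl , refl) =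
          Sum.[ (λ eq → contradiction (sym eq) u≢v) , G.symm ]′ a
        from : G.Adj u v → Joined u v
        from u~v = u≢v , P.edge (u , zero) (v , zero) (u≢v ∘ cong proj₁ , inj₂ u~v , inj₁ refl) ,
          _ , _ , inj₁ refl , inj₂ refl , refl , refl
          where
          u≢v : u ≢ v
          u≢v refl = G.irrefl refl u~v

  -- Each edge of G has two copies between the layers S₀ and S₁ of the product,
  -- so that a set of edges can code a relation that is not symmetric.
  Coded : (S₀ S₁ : P.V → Bool) → P.EdgeSet → G.V → G.V → Set
  Coded S₀ S₁ E u v = ∃[ e ] ∃[ s ] ∃[ t ] T (P.member E e) × T (S₀ s) × T (S₁ t) ×
    P.Incident e s × P.Incident e t × u ≡ proj₁ s × v ≡ proj₁ t

  opaque
    unfolding labᶠ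

    labᶠ⇔ : ∀ {Γ} (ρ : Env Γ) (h : edgeSet ∈ Γ) → All.lookup ρ h ≡ horizontal G (cycle k) →
      ∀ S₀ S₁ E x y → Sat ρ (labᶠ h S₀ S₁ E x y) ⇔
        Coded (All.lookup ρ S₀) (All.lookup ρ S₁) (All.lookup ρ E) (proj₁ (All.lookup ρ x)) (proj₁ (All.lookup ρ y))
    labᶠ⇔ ρ h hor S₀ S₁ E x y = ∃-⇔ λ e → ∃-⇔ λ s → ∃-⇔ λ t →
      ⇔-refl ×-⇔ ⇔-refl ×-⇔ ⇔-refl ×-⇔ ⇔-refl ×-⇔ ⇔-refl ×-⇔
      same⇔ (bind ρ e s t) (3+ h) hor (3+ x) v₁ ×-⇔ same⇔ (bind ρ e s t) (3+ h) hor (3+ y) v₀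

  module _ (lab : G.V → G.V → ℕ) where
    private
      S₀ S₁ : P.V → Bool
      S₀ z = ⌊ proj₂ z ≟ᶠ zero ⌋
      S₁ z = ⌊ proj₂ z ≟ᶠ suc zero ⌋

      Arrow : Fin k → P.V → P.V → Set
      Arrow i s t = proj₂ s ≡ zero × proj₂ t ≡ suc zero × lab (proj₁ s) (proj₁ t) ≡ toℕ i

      arrow? : ∀ i s t → Dec (Arrow i s t)
      arrow? i s t = (proj₂ s ≟ᶠ zero) ×-dec (proj₂ t ≟ᶠ suc zero) ×-dec (lab (proj₁ s) (proj₁ t) ℕ.≟ toℕ i)

    -- The end in layer 0 is the source of the coded pair, whichever way the `Edge` happens to be
    -- oriented.
    labelEdges : Fin k → P.EdgeSet
    labelEdges i = record
      { member = λ e → ⌊ arrow? i (P.src e) (P.tgt e) ⊎-dec arrow? i (P.tgt e) (P.src e) ⌋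
      ; resp   = λ { (inj₁ (refl , refl)) → refl ; (inj₂ (refl , refl)) → ⌊⌋-cong Sum.swap Sum.swap }
      }

    coded⇒lab : ∀ {i u v} → Coded S₀ S₁ (labelEdges i) u v → lab u v ≡ toℕ i
    coded⇒lab (e , s , t , e∈ , s∈ , t∈ , incs , inct , refl , refl) =
      core (toWitness e∈) incs inct (toWitness s∈) (toWitness t∈)
      where
      core : Arrow _ (P.src e) (P.tgt e) ⊎ Arrow _ (P.tgt e) (P.src e) → P.Incident e s → P.Incident e t →
        proj₂ s ≡ zero → proj₂ t ≡ suc zero → lab (proj₁ s) (proj₁ t) ≡ toℕ _
      core (inj₁ (_ , _ , eq)) (inj₁ refl) (inj₂ refl) _ _ = eq
      core (inj₂ (_ , _ , eq)) (inj₂ refl) (inj₁ refl) _ _ = eq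
      core (inj₁ (p , q , _))  (inj₂ refl) _ r _ = contradiction (trans (sym q) r) λ ()
      core (inj₁ (p , q , _))  (inj₁ refl) (inj₁ refl) _ r = contradiction (trans (sym p) r) λ ()
      core (inj₂ (p , q , _))  (inj₁ refl) _ r _ = contradiction (trans (sym q) r) λ ()
      core (inj₂ (p , q , _))  (inj₂ refl) (inj₂ refl) _ r = contradiction (trans (sym p) r) λ ()

    lab⇒coded : ∀ {i u v} → G.Adj u v → lab u v ≡ toℕ i → Coded S₀ S₁ (labelEdges i) u v
    lab⇒coded {i} {u} {v} u~v eq =
      P.edge (u , zero) (v , suc zero) ((λ ()) , inj₂ u~v , inj₂ ((λ ()) , inj₁ (inj₁ refl))) ,
      _ , _ ,
      fromWitness {a? = arrow? i (u , zero) (v , suc zero) ⊎-dec arrow? i (v , suc zero) (u , zero)}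
        (inj₁ (refl , refl , eq)) ,
      fromWitness {a? = zero {n = suc k′} ≟ᶠ zero} refl ,
      fromWitness {a? = suc {n = suc k′} zero ≟ᶠ suc zero} refl ,
      inj₁ refl , inj₂ refl , refl , refl

-- The labelling conditions as a formula.

Tri : (a b c d e f : ℕ) → Set
Tri a b c d e f = a + c + f ≡ b + d + e × (e ≤ a ⊎ f ≤ d)

tri? : ∀ a b c d e f → Dec (Tri a b c d e f)
tri? a b c d e f = (a + c + f ℕ.≟ b + d + e) ×-dec ((e ≤? a) ⊎-dec (f ≤? d))

Far : (k a b c d : ℕ) → Set
Far k a b c d = k + c < a + b + d ⊎ k + b < a + c + d

far? : ∀ k a b c d → Dec (Far k a b c d)
far? k a b c d = (suc (k + c) ≤? a + b + d) ⊎-dec (suc (k + b) ≤? a + c + d)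

record Variables (k : ℕ) (Γ : Context) : Set where
  constructor variables
  field
    h     : edgeSet ∈ Γ
    S₀ S₁ : vertexSet ∈ Γ
    E     : Fin k → edgeSet ∈ Γ

  labelᶠ : Fin k → vertex ∈ Γ → vertex ∈ Γ → Formula Γ
  labelᶠ i = labᶠ h S₀ S₁ (E i)

weaken : ∀ {k Γ s} → Variables k Γ → Variables k (s ∷ Γ)
weaken (variables h S₀ S₁ E) = variables (there h) (there S₀) (there S₁) (there ∘ E)

module _ (k : ℕ) {Γ : Context} (x : Variables k Γ) where
  private
    x₂ : ∀ {s t} → Variables k (s ∷ t ∷ Γ)
    x₂ = weaken (weaken x)
    x₃ : ∀ {s t u} → Variables k (s ∷ t ∷ u ∷ Γ)
    x₃ = weaken x₂
    module x₂ {s t} = Variables (x₂ {s} {t})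
    module x₃ {s t u} = Variables (x₃ {s} {t} {u})

  totalᶠ sumᶠ triᶠ farᶠ elimᶠ labellingᶠ : Formula Γ

  totalᶠ = all′ vertex (all′ vertex (adjᶠ x₂.h v₁ v₀ ⇒ ⋁ k λ i → x₂.labelᶠ i v₁ v₀))

  sumᶠ = all′ vertex (all′ vertex (adjᶠ x₂.h v₁ v₀ ⇒ ⋀ k λ i → ⋀ k λ j →
    x₂.labelᶠ i v₁ v₀ ⇒ x₂.labelᶠ j v₀ v₁ ⇒ ⌈ (1 ≤? toℕ i) ×-dec (toℕ i + toℕ j ≤? k) ⌉))

  triᶠ = all′ vertex (all′ vertex (all′ vertex
    (adjᶠ x₃.h v₂ v₁ ⇒ adjᶠ x₃.h v₁ v₀ ⇒ adjᶠ x₃.h v₂ v₀ ⇒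
     ⋀ k λ a → ⋀ k λ b → ⋀ k λ c → ⋀ k λ d → ⋀ k λ e → ⋀ k λ f →
     x₃.labelᶠ a v₂ v₁ ⇒ x₃.labelᶠ b v₁ v₂ ⇒ x₃.labelᶠ c v₁ v₀ ⇒ x₃.labelᶠ d v₀ v₁ ⇒
     x₃.labelᶠ e v₂ v₀ ⇒ x₃.labelᶠ f v₀ v₂ ⇒
     ⌈ tri? (toℕ a) (toℕ b) (toℕ c) (toℕ d) (toℕ e) (toℕ f) ⌉)))

  farᶠ = all′ vertex (all′ vertex (all′ vertex
    (adjᶠ x₃.h v₂ v₁ ⇒ adjᶠ x₃.h v₁ v₀ ⇒ ¬ᶠ adjᶠ x₃.h v₂ v₀ ⇒ ¬ᶠ sameᶠ x₃.h v₂ v₀ ⇒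
     ⋀ k λ a → ⋀ k λ b → ⋀ k λ c → ⋀ k λ d →
     x₃.labelᶠ a v₂ v₁ ⇒ x₃.labelᶠ b v₁ v₂ ⇒ x₃.labelᶠ c v₁ v₀ ⇒ x₃.labelᶠ d v₀ v₁ ⇒
     ⌈ far? k (toℕ a) (toℕ b) (toℕ c) (toℕ d) ⌉)))

  elimᶠ = all′ vertexSet (ex′ vertex (v₀ ∈ⱽ v₁) ⇒
    ex′ vertex (v₀ ∈ⱽ v₁ ∧ all′ vertex (v₀ ∈ⱽ v₂ ⇒ adjᶠ x₃.h v₁ v₀ ⇒ ⋀ k λ i → ⋀ k λ j →
      x₃.labelᶠ i v₀ v₁ ⇒ x₃.labelᶠ j v₁ v₀ ⇒ ⌈ toℕ i ≤? toℕ j ⌉)))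

  labellingᶠ = totalᶠ ∧ sumᶠ ∧ triᶠ ∧ farᶠ ∧ elimᶠ

-- Correctness of the labelling formula.

module _ (k′ : ℕ) (G : Graph) where
  private
    k : ℕ
    k = suc (suc k′)
    P : Graph
    P = G ⊠ cycle k
    module P = Graph P
  open Graph G
  open Semantics P

  -- Edge sets chosen by a quantifier may give a pair several labels. `r-total` asks for at least
  -- one, and the other conditions are imposed on every combination of labels, so that any choice of
  -- one label for each pair is a labelling.
  record IsRelLabelling (R : Fin k → V → V → Set) : Set where
    field
      r-total : ∀ u v → Adj u v → ∃[ i ] R i u v
      r-sum   : ∀ u v → Adj u v → ∀ i j → R i u v → R j v u → 1 ≤ toℕ i × toℕ i + toℕ j ≤ k
      r-tri   : ∀ v p w → Adj v p → Adj p w → Adj v w → ∀ a b c d e f →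
        R a v p → R b p v → R c p w → R d w p → R e v w → R f w v →
        Tri (toℕ a) (toℕ b) (toℕ c) (toℕ d) (toℕ e) (toℕ f)
      r-far   : ∀ v p w → Adj v p → Adj p w → ¬ Adj v w → v ≢ w → ∀ a b c d →
        R a v p → R b p v → R c p w → R d w p → Far k (toℕ a) (toℕ b) (toℕ c) (toℕ d)
      r-elim  : ∀ (X : P.V → Bool) → ∃[ u ] T (X u) →
        ∃[ v ] T (X v) × (∀ a → T (X a) → Adj (proj₁ v) (proj₁ a) → ∀ i j →
          R i (proj₁ a) (proj₁ v) → R j (proj₁ v) (proj₁ a) → toℕ i ≤ toℕ j)

  open IsRelLabelling

  ∀ⱽ : {A : P.V → Set} {B : V → Set} → (∀ x → A x ⇔ B (proj₁ x)) → (∀ x → A x) ⇔ (∀ u → B u)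
  ∀ⱽ eq = mk⇔ (λ f u → eq (u , zero) .Equivalence.to (f (u , zero)))
              (λ f x → eq x .Equivalence.from (f (proj₁ x)))

  ∃ⱽ : {A : P.V → Set} {B : V → Set} → (∀ x → A x ⇔ B (proj₁ x)) → ∃ A ⇔ ∃ B
  ∃ⱽ eq = mk⇔ (λ (x , a) → proj₁ x , eq x .Equivalence.to a)
              (λ (u , b) → (u , zero) , eq (u , zero) .Equivalence.from b)

  module _ {Γ} (ρ : Env Γ) (x : Variables k Γ) {S₀ S₁ : P.V → Bool} {E : Fin k → P.EdgeSet}
    (h-eq : All.lookup ρ (Variables.h x) ≡ horizontal G (cycle k))
    (S₀-eq : All.lookup ρ (Variables.S₀ x) ≡ S₀)
    (S₁-eq : All.lookup ρ (Variables.S₁ x) ≡ S₁)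
    (E-eq : ∀ i → All.lookup ρ (Variables.E x i) ≡ E i) where

    private
      R : Fin k → V → V → Set
      R i = Coded k′ G S₀ S₁ (E i)

      bind₂ : P.V → P.V → Env (vertex ∷ vertex ∷ Γ)
      bind₂ u v = All._∷_ {x = vertex} v (All._∷_ {x = vertex} u ρ)

      bind₃ : P.V → P.V → P.V → Env (vertex ∷ vertex ∷ vertex ∷ Γ)
      bind₃ u v w = All._∷_ {x = vertex} w (bind₂ u v)

      bindX : (P.V → Bool) → P.V → P.V → Env (vertex ∷ vertex ∷ vertexSet ∷ Γ)
      bindX X v a = All._∷_ {x = vertex} a (All._∷_ {x = vertex} v (All._∷_ {x = vertexSet} X ρ))

      label : ∀ {Δ} (σ : Env Δ) (y : Variables k Δ) →
        All.lookup σ (Variables.h y) ≡ horizontal G (cycle k) →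
        All.lookup σ (Variables.S₀ y) ≡ S₀ → All.lookup σ (Variables.S₁ y) ≡ S₁ →
        (∀ i → All.lookup σ (Variables.E y i) ≡ E i) → ∀ i s t →
        Sat σ (Variables.labelᶠ y i s t) ⇔ R i (proj₁ (All.lookup σ s)) (proj₁ (All.lookup σ t))
      label σ (variables h s₀ s₁ e) hor refl refl e-eq i s t =
        subst (λ F → Sat σ (labᶠ h s₀ s₁ (e i) s t) ⇔ Coded k′ G _ _ F _ _) (e-eq i)
          (labᶠ⇔ k′ G σ h hor s₀ s₁ (e i) s t)

      label₂ : ∀ u v i s t → _
      label₂ u v = label (bind₂ u v) (weaken (weaken x)) h-eq S₀-eq S₁-eq E-eq

      label₃ : ∀ u v w i s t → _
      label₃ u v w = label (bind₃ u v w) (weaken (weaken (weaken x))) h-eq S₀-eq S₁-eq E-eq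

      labelX : ∀ X v a i s t → _
      labelX X v a = label (bindX X v a) (weaken (weaken (weaken x))) h-eq S₀-eq S₁-eq E-eq

      adj₂ : ∀ u v s t → _
      adj₂ u v = adjᶠ⇔ k′ G (bind₂ u v) (there (there (Variables.h x))) h-eq

      adj₃ : ∀ u v w s t → _
      adj₃ u v w = adjᶠ⇔ k′ G (bind₃ u v w) (3+ (Variables.h x)) h-eq

      total⇔ : Sat ρ (totalᶠ k x) ⇔ (∀ u v → Adj u v → ∃[ i ] R i u v)
      total⇔ = ∀ⱽ λ u → ∀ⱽ λ v → adj₂ u v v₁ v₀ ⇒-⇔ ⋁⇔ k′ G λ i → label₂ u v i v₁ v₀

      sum⇔ : Sat ρ (sumᶠ k x) ⇔
        (∀ u v → Adj u v → ∀ i j → R i u v → R j v u → 1 ≤ toℕ i × toℕ i + toℕ j ≤ k)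
      sum⇔ = ∀ⱽ λ u → ∀ⱽ λ v → adj₂ u v v₁ v₀ ⇒-⇔ ⋀⇔ k′ G λ i → ⋀⇔ k′ G λ j →
        label₂ u v i v₁ v₀ ⇒-⇔ label₂ u v j v₀ v₁ ⇒-⇔ ⌈⌉⇔ k′ G _

      tri⇔ : Sat ρ (triᶠ k x) ⇔ (∀ v p w → Adj v p → Adj p w → Adj v w → ∀ a b c d e f →
        R a v p → R b p v → R c p w → R d w p → R e v w → R f w v →
        Tri (toℕ a) (toℕ b) (toℕ c) (toℕ d) (toℕ e) (toℕ f))
      tri⇔ = ∀ⱽ λ v → ∀ⱽ λ p → ∀ⱽ λ w →
        adj₃ v p w v₂ v₁ ⇒-⇔ adj₃ v p w v₁ v₀ ⇒-⇔ adj₃ v p w v₂ v₀ ⇒-⇔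
        ⋀⇔ k′ G λ a → ⋀⇔ k′ G λ b → ⋀⇔ k′ G λ c → ⋀⇔ k′ G λ d → ⋀⇔ k′ G λ e → ⋀⇔ k′ G λ f →
        label₃ v p w a v₂ v₁ ⇒-⇔ label₃ v p w b v₁ v₂ ⇒-⇔ label₃ v p w c v₁ v₀ ⇒-⇔
        label₃ v p w d v₀ v₁ ⇒-⇔ label₃ v p w e v₂ v₀ ⇒-⇔ label₃ v p w f v₀ v₂ ⇒-⇔ ⌈⌉⇔ k′ G _

      far⇔ : Sat ρ (farᶠ k x) ⇔ (∀ v p w → Adj v p → Adj p w → ¬ Adj v w → v ≢ w → ∀ a b c d →
        R a v p → R b p v → R c p w → R d w p → Far k (toℕ a) (toℕ b) (toℕ c) (toℕ d))
      far⇔ = ∀ⱽ λ v → ∀ⱽ λ p → ∀ⱽ λ w →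
        adj₃ v p w v₂ v₁ ⇒-⇔ adj₃ v p w v₁ v₀ ⇒-⇔ (adj₃ v p w v₂ v₀ ⇒-⇔ ⇔-refl) ⇒-⇔
        (same⇔ k′ G (bind₃ v p w) (3+ (Variables.h x)) h-eq v₂ v₀ ⇒-⇔ ⇔-refl) ⇒-⇔
        ⋀⇔ k′ G λ a → ⋀⇔ k′ G λ b → ⋀⇔ k′ G λ c → ⋀⇔ k′ G λ d →
        label₃ v p w a v₂ v₁ ⇒-⇔ label₃ v p w b v₁ v₂ ⇒-⇔ label₃ v p w c v₁ v₀ ⇒-⇔
        label₃ v p w d v₀ v₁ ⇒-⇔ ⌈⌉⇔ k′ G _

      elim⇔ : Sat ρ (elimᶠ k x) ⇔ (∀ (X : P.V → Bool) → ∃[ u ] T (X u) →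
        ∃[ v ] T (X v) × (∀ a → T (X a) → Adj (proj₁ v) (proj₁ a) → ∀ i j →
          R i (proj₁ a) (proj₁ v) → R j (proj₁ v) (proj₁ a) → toℕ i ≤ toℕ j))
      elim⇔ = ∀-⇔ λ X → ⇔-refl ⇒-⇔ ∃-⇔ λ v → ⇔-refl ×-⇔ ∀-⇔ λ a → ⇔-refl ⇒-⇔
        adjᶠ⇔ k′ G (bindX X v a) (3+ (Variables.h x)) h-eq v₁ v₀ ⇒-⇔ ⋀⇔ k′ G λ i → ⋀⇔ k′ G λ j →
        labelX X v a i v₀ v₁ ⇒-⇔ labelX X v a j v₁ v₀ ⇒-⇔ ⌈⌉⇔ k′ G _

    labellingᶠ⇔ : Sat ρ (labellingᶠ k x) ⇔ IsRelLabelling (λ i → Coded k′ G S₀ S₁ (E i))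
    labellingᶠ⇔ = ⇔-trans (total⇔ ×-⇔ sum⇔ ×-⇔ tri⇔ ×-⇔ far⇔ ×-⇔ elim⇔) (mk⇔
      (λ (t , s , c , f , e) → record { r-total = t ; r-sum = s ; r-tri = c ; r-far = f ; r-elim = e })
      (λ L → r-total L , r-sum L , r-tri L , r-far L , r-elim L))

  module _ {R : Fin k → V → V → Set} where

    relLabelling : ∀ {lab} → IsLabelling k G lab →
      (∀ {i u v} → R i u v → lab u v ≡ toℕ i) → (∀ {i u v} → Adj u v → lab u v ≡ toℕ i → R i u v) →
      IsRelLabelling R
    relLabelling {lab} L sound complete = record
      { r-total = λ u v u~v → fromℕ< (bounded u~v) , complete u~v (sym (toℕ-fromℕ< (bounded u~v)))
      ; r-sum = r-sum′ ; r-tri = r-tri′ ; r-far = r-far′ ; r-elim = r-elim′ }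
      where
      open IsLabelling L
      -- The opposite label is positive and the sum is at most k, hence k values, from 0 to k - 1,
      -- suffice.
      bounded : ∀ {u v} → Adj u v → lab u v < k
      bounded u~v = ≤-trans (m<m+n _ (lab-pos (symm u~v))) (lab-sum u~v)
      r-sum′ : ∀ u v → Adj u v → ∀ i j → R i u v → R j v u → 1 ≤ toℕ i × toℕ i + toℕ j ≤ k
      r-sum′ u v u~v i j ri rj rewrite sym (sound ri) | sym (sound rj) = lab-pos u~v , lab-sum u~v
      r-tri′ : ∀ v p w → Adj v p → Adj p w → Adj v w → ∀ a b c d e f →
        R a v p → R b p v → R c p w → R d w p → R e v w → R f w v →
        Tri (toℕ a) (toℕ b) (toℕ c) (toℕ d) (toℕ e) (toℕ f)
      r-tri′ v p w vp pw vw a b c d e f ra rb rc rd re rf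
        rewrite sym (sound ra) | sym (sound rb) | sym (sound rc) | sym (sound rd) | sym (sound re) | sym (sound rf) =
        lab-tri vp pw vw
      r-far′ : ∀ v p w → Adj v p → Adj p w → ¬ Adj v w → v ≢ w → ∀ a b c d →
        R a v p → R b p v → R c p w → R d w p → Far k (toℕ a) (toℕ b) (toℕ c) (toℕ d)
      r-far′ v p w vp pw vw v≢w a b c d ra rb rc rd
        rewrite sym (sound ra) | sym (sound rb) | sym (sound rc) | sym (sound rd) =
        lab-far vp pw vw v≢w
      r-elim′ : ∀ (X : P.V → Bool) → ∃[ u ] T (X u) →
        ∃[ v ] T (X v) × (∀ a → T (X a) → Adj (proj₁ v) (proj₁ a) → ∀ i j →
          R i (proj₁ a) (proj₁ v) → R j (proj₁ v) (proj₁ a) → toℕ i ≤ toℕ j)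
      r-elim′ X ((u , j) , Xu)
        -- Here X is a set of vertices of the product: `lab-elim` is applied to its projection to G,
        -- and the vertex found is lifted to one of its copies in X.
        with v , Xv , low ← lab-elim (λ u → ⌊ any? (λ i → T? (X (u , i))) ⌋) (u , fromWitness (j , Xu)) =
        (v , proj₁ (toWitness Xv)) , proj₂ (toWitness Xv) , λ (a , i) Xa v~a i j ri rj →
          subst₂ _≤_ (sound ri) (sound rj) (low a (fromWitness (_ , Xa)) v~a)

    fromRelLabelling : IsRelLabelling R → ∃ (IsLabelling k G)
    fromRelLabelling L = lab , record
      { lab-pos = λ u~v → let i , ri , eq = lab-at u~v ; j , rj , eq′ = lab-at (symm u~v) in
          subst (1 ≤_) (sym eq) (proj₁ (r-sum L _ _ u~v i j ri rj))
      ; lab-sum = λ u~v → let i , ri , eq = lab-at u~v ; j , rj , eq′ = lab-at (symm u~v) in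
          subst₂ (λ a b → a + b ≤ k) (sym eq) (sym eq′) (proj₂ (r-sum L _ _ u~v i j ri rj))
      ; lab-tri = lab-tri′
      ; lab-far = lab-far′
      ; lab-elim = lab-elim′
      }
      where
      lab : V → V → ℕ
      lab u v with adj? u v
      ... | yes u~v = toℕ (proj₁ (r-total L u v u~v))
      ... | no _    = 0
      lab-at : ∀ {u v} → Adj u v → ∃[ i ] R i u v × lab u v ≡ toℕ i
      lab-at {u} {v} u~v with adj? u v
      ... | yes u~v = let i , ri = r-total L u v u~v in i , ri , refl
      ... | no u≁v  = contradiction u~v u≁v
      lab-tri′ : ∀ {v p w} → Adj v p → Adj p w → Adj v w →
        Tri (lab v p) (lab p v) (lab p w) (lab w p) (lab v w) (lab w v)
      lab-tri′ vp pw vw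
        with a , ra , ea ← lab-at vp | b , rb , eb ← lab-at (symm vp) | c , rc , ec ← lab-at pw
           | d , rd , ed ← lab-at (symm pw) | e , re , ee ← lab-at vw | f , rf , ef ← lab-at (symm vw)
        rewrite ea | eb | ec | ed | ee | ef = r-tri L _ _ _ vp pw vw a b c d e f ra rb rc rd re rf
      lab-far′ : ∀ {v p w} → Adj v p → Adj p w → ¬ Adj v w → v ≢ w →
        Far k (lab v p) (lab p v) (lab p w) (lab w p)
      lab-far′ vp pw vw v≢w
        with a , ra , ea ← lab-at vp | b , rb , eb ← lab-at (symm vp) | c , rc , ec ← lab-at pw
           | d , rd , ed ← lab-at (symm pw)
        rewrite ea | eb | ec | ed = r-far L _ _ _ vp pw vw v≢w a b c d ra rb rc rd
      lab-elim′ : ∀ (X : V → Bool) → ∃[ u ] T (X u) →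
        ∃[ v ] T (X v) × (∀ a → T (X a) → Adj v a → lab a v ≤ lab v a)
      lab-elim′ X (u , Xu) with (v , _) , Xv , low ← r-elim L (X ∘ proj₁) ((u , zero) , Xu) =
        v , Xv , λ a Xa v~a → let i , ri , eq = lab-at (symm v~a) ; j , rj , eq′ = lab-at v~a in
          subst₂ _≤_ (sym eq) (sym eq′) (low (a , zero) Xa v~a i j ri rj)

-- Quantification over the label sets, and the final formula.

block : ℕ → Context → Context
block n Γ = replicate n edgeSet ++ Γ

old : ∀ n {Γ s} → s ∈ Γ → s ∈ block n Γ
old zero    x = x
old (suc n) x = there (old n x)

new : ∀ n {Γ} → Fin n → edgeSet ∈ block n Γ
new (suc n) zero    = here refl
new (suc n) (suc i) = there (new n i)

exs : ∀ n {Γ} → Formula (block n Γ) → Formula Γ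
exs zero    φ = φ
exs (suc n) φ = exs n (ex′ edgeSet φ)

module _ (G : Graph) where
  open Graph G
  open Semantics G

  extend : ∀ {n Γ} → (Fin n → EdgeSet) → Env Γ → Env (block n Γ)
  extend {zero}  E ρ = ρ
  extend {suc n} E ρ = All._∷_ {x = edgeSet} (E zero) (extend (E ∘ suc) ρ)

  lookup-old : ∀ {n Γ s} (E : Fin n → EdgeSet) (ρ : Env Γ) (x : s ∈ Γ) →
    All.lookup (extend E ρ) (old n x) ≡ All.lookup ρ x
  lookup-old {zero}  E ρ x = refl
  lookup-old {suc n} E ρ x = lookup-old (E ∘ suc) ρ x

  lookup-new : ∀ {n Γ} (E : Fin n → EdgeSet) (ρ : Env Γ) i → All.lookup (extend E ρ) (new n i) ≡ E i
  lookup-new {suc n} E ρ zero    = refl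
  lookup-new {suc n} E ρ (suc i) = lookup-new (E ∘ suc) ρ i

  exs⇔ : ∀ n {Γ} {ρ : Env Γ} {φ : Formula (block n Γ)} → Sat ρ (exs n φ) ⇔ (∃[ E ] Sat (extend {n} E ρ) φ)
  exs⇔ zero    = mk⇔ (λ s → (λ ()) , s) proj₂
  exs⇔ (suc n) = ⇔-trans (exs⇔ n) (mk⇔
    (λ (E , F , s) → (λ { zero → F ; (suc i) → E i }) , s)
    (λ (E , s) → E ∘ suc , E zero , s))

-- The first conjunct says that G does not have exactly one vertex. A single vertex satisfies the
-- labelling conditions but is not a leaf power; the empty graph is one.
leafPowerᶠ : ℕ → Formula (edgeSet ∷ [])
leafPowerᶠ k = all′ vertex (ex′ vertex (¬ᶠ sameᶠ v₂ v₁ v₀)) ∧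
  ex′ vertexSet (ex′ vertexSet (exs k (labellingᶠ k (variables (old k v₂) (old k v₁) (old k v₀) (new k)))))

module _ (k′ : ℕ) (G : Graph) where
  private
    k : ℕ
    k = suc (suc k′)
    P : Graph
    P = G ⊠ cycle k
    module P = Graph P
  open Graph G
  open Semantics P

  private
    ρ₀ : Env (edgeSet ∷ [])
    ρ₀ = All._∷_ {x = edgeSet} (horizontal G (cycle k)) All.[]

    ρ₂ : (S₀ S₁ : P.V → Bool) → Env (vertexSet ∷ vertexSet ∷ edgeSet ∷ [])
    ρ₂ S₀ S₁ = All._∷_ {x = vertexSet} S₁ (All._∷_ {x = vertexSet} S₀ ρ₀)

    others⇔ : Sat ρ₀ (all′ vertex (ex′ vertex (¬ᶠ sameᶠ v₂ v₁ v₀))) ⇔ (∀ u → ∃[ v ] u ≢ v)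
    others⇔ = ∀ⱽ k′ G λ u → ∃ⱽ k′ G λ v →
      same⇔ k′ G (All._∷_ {x = vertex} v (All._∷_ {x = vertex} u ρ₀)) v₂ refl v₁ v₀ ⇒-⇔ ⇔-refl

    labelling⇔ : Sat ρ₀ (ex′ vertexSet (ex′ vertexSet (exs k (labellingᶠ k
                   (variables (old k v₂) (old k v₁) (old k v₀) (new k)))))) ⇔
      (∃[ S₀ ] ∃[ S₁ ] ∃[ E ] IsRelLabelling k′ G (λ i → Coded k′ G S₀ S₁ (E i)))
    labelling⇔ = ∃-⇔ λ S₀ → ∃-⇔ λ S₁ → ⇔-trans (exs⇔ P k) (∃-⇔ λ E →
      labellingᶠ⇔ k′ G (extend P E (ρ₂ S₀ S₁)) (variables (old k v₂) (old k v₁) (old k v₀) (new k))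
        (lookup-old P E (ρ₂ S₀ S₁) v₂) (lookup-old P E (ρ₂ S₀ S₁) v₁)
        (lookup-old P E (ρ₂ S₀ S₁) v₀) (lookup-new P E (ρ₂ S₀ S₁)))

  leafPowerᶠ⇔ : IsLeafPower k G ⇔ (P , horizontal G (cycle k) ⊨ leafPowerᶠ k)
  leafPowerᶠ⇔ = mk⇔ to from
    where
    to : IsLeafPower k G → Sat ρ₀ (leafPowerᶠ k)
    to (T , tree , iso) =
      let _ , addr = leafPower⇒addressing tree iso (s≤s (s≤s z≤n))
          lab , L = labelling addr
      in others⇔ .Equivalence.from (otherVertex tree iso)
       , labelling⇔ .Equivalence.from
           (_ , _ , labelEdges k′ G lab , relLabelling k′ G L (coded⇒lab k′ G lab) (lab⇒coded k′ G lab))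

    from : Sat ρ₀ (leafPowerᶠ k) → IsLeafPower k G
    from (others , s) =
      let _ , _ , _ , rel = labelling⇔ .Equivalence.to s
          _ , L = fromRelLabelling k′ G rel
          _ , addr = addressing (s≤s z≤n) L
      in addressing⇒leafPower addr (others⇔ .Equivalence.to others)

corollary6 : (k : ℕ) → 2 ≤ k →
    Σ (Formula (edgeSet ∷ [])) λ φ →
    (G : Graph) → IsLeafPower k G ⇔ (G ⊠ cycle k , horizontal G (cycle k) ⊨ φ)
corollary6 (suc (suc k′)) _ = leafPowerᶠ (suc (suc k′)) , leafPowerᶠ⇔ k′
corollary6 (suc zero) (s≤s ())
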